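{- Let $n\ge1$, let $\sigma\in\mathcal{S}_n$ be a cycle of length $n$, and let $\Gamma_n=(V_n,\Psi)$, $\prec$ and $f$ be as in the context. Then for every vertex $\langle k,l\rangle\in V_n$, $$|f(\langle k,l\rangle)|=\frac1k\left((k-1)!\left(\frac nk\right)^{k-1}-\sum_{\langle r,t\rangle\prec\langle k,l\rangle} r\,|f(\langle r,t\rangle)|\right).$$
   Context: $\mathbb{N}$ is the set of nonnegative integers; $[n]=\{1,\dots,n\}$; $\mathcal{S}_n$ is the symmetric group on $[n]$ with products composed left to right, $(\alpha\beta)(i)=\beta(\alpha(i))$. For $x,y\in[n]$, $x\odot y$ is the element of $[n]$ congruent to $xy$ mod $n$. $\alpha,\beta\in\mathcal{S}_n$ are $\sigma$-equivalent if $\sigma^a\alpha=\beta\sigma^b$ for some $a,b\in\mathbb{N}$; $K_\xi$ denotes the class of $\xi$ and $Q_n$ the set of classes. The directed graph $\Gamma_n=(V_n,\Psi)$ with $V_n\subseteq[n]\times[n]$ is built as follows: (1) for each $l$ with $1\le l<n$ and $\gcd(l,n)=1$, $\langle1,l\rangle\in V_n$; (2) whenever $\langle k,l\rangle\in V_n$ and $p$ is a prime divisor of $n$ with $kp\mid n$, then $\langle kp,l\odot p\rangle\in V_n$ and $(\langle k,l\rangle,\langle kp,l\odot p\rangle)\in\Psi$; (3) repeat (2) until nothing new arises (so $V_n,\Psi$ are the smallest sets closed under these rules). Write $\langle r,t\rangle\prec\langle k,l\rangle$ if there is a directed path of positive length in $\Gamma_n$ from $\langle r,t\rangle$ to $\langle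 k,l\rangle$. Define $f$ on $V_n$ by: for $\langle k,l\rangle\in V_n$ with $k<n$, $f(\langle k,l\rangle)$ is the set of classes $K_\xi\in Q_n$ with $\sigma^k\xi=\xi\sigma^l$ and $\sigma^{k_1}\xi\ne\xi\sigma^{l_1}$ for all $1\le k_1<k$ and all $l_1$; and $f(\langle n,n\rangle)$ is the set of classes $K_\xi\in Q_n$ with $|K_\xi|=n^2$. -}

module Defs where

open import Data.Nat using (ℕ; zero; suc; _+_; _*_; _∸_; _^_; _≤_; _<_; _!; _/_; _%_)
open import Data.Nat.Divisibility using (_∣_)
open import Data.Nat.GCD using (gcd)
open import Data.Nat.Primality using (Prime)
open import Data.Fin using (Fin)
open import Data.Vec using (Vec; lookup; map; allFin)
open import Data.List using (List; length)
open import Data.Nat.ListAction using (sum)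
import Data.List as L
open import Data.List.Membership.Propositional using (_∈_)
open import Data.List.Relation.Unary.Unique.Propositional using (Unique)
open import Data.List.Relation.Unary.All using (All)
open import Data.List.Relation.Unary.Any using (Any)
open import Data.List.Relation.Unary.AllPairs using (AllPairs)
open import Data.Product using (Σ; ∃; _×_; _,_; proj₁; proj₂)
open import Data.Sum using (_⊎_)
open import Relation.Nullary using (¬_)
open import Relation.Binary.PropositionalEquality using (_≡_; _≢_)
open import Relation.Binary.Construct.Closure.Transitive using (TransClosure)
open import Function.Bundles using (_⇔_)

-- Permutations of [n], represented in one-line notation as vectors
-- (the set [n] = {1..n} is represented by Fin n = {0..n-1}).

Perm : ℕ → Set
Perm n = Vec (Fin n) n

app : ∀ {n} → Perm n → Fin n → Fin n
app α i = lookup α i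

IsPerm : ∀ {n} → Perm n → Set
IsPerm α = ∀ i j → app α i ≡ app α j → i ≡ j

-- product composed left to right: (α · β)(i) = β(α(i))
infixl 7 _·_
_·_ : ∀ {n} → Perm n → Perm n → Perm n
α · β = map (lookup β) α

idP : ∀ n → Perm n
idP n = allFin n

infixr 8 _^ₚ_
_^ₚ_ : ∀ {n} → Perm n → ℕ → Perm n
_^ₚ_ {n} σ zero = idP n
σ ^ₚ suc a = σ · (σ ^ₚ a)

IsNCycle : ∀ {n} → Perm n → Set
IsNCycle {n} σ =
  Σ (ℕ → Fin n) λ a →
    (∀ i j → i < n → j < n → a i ≡ a j → i ≡ j) ×
    (∀ j → app σ (a j) ≡ a (suc j))

SigmaEquiv : ∀ {n} → Perm n → Perm n → Perm n → Set
SigmaEquiv σ α β = Σ ℕ λ a → Σ ℕ λ b → (σ ^ₚ a) · α ≡ β · (σ ^ₚ b)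

ClassSize : ∀ {n} → Perm n → Perm n → ℕ → Set
ClassSize {n} σ ξ m =
  Σ (List (Perm n)) λ Ls →
    Unique Ls × (∀ β → (β ∈ Ls) ⇔ (IsPerm β × SigmaEquiv σ ξ β)) × length Ls ≡ m

-- The number of classes K_ξ ∈ Q_n (ξ ∈ S_n) with P ξ is m:
-- a list of m pairwise non-equivalent representatives satisfying P such that
-- every ξ ∈ S_n with P ξ is equivalent to one of them.
NumClasses : ∀ {n} → Perm n → (Perm n → Set) → ℕ → Set
NumClasses {n} σ P m =
  Σ (List (Perm n)) λ Ls →
    length Ls ≡ m ×
    All (λ ξ → IsPerm ξ × P ξ) Ls ×
    AllPairs (λ α β → ¬ SigmaEquiv σ α β) Ls ×
    (∀ ξ → IsPerm ξ → P ξ → Any (SigmaEquiv σ ξ) Ls)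

SumOver : (ℕ × ℕ → Set) → (ℕ × ℕ → ℕ) → ℕ → Set
SumOver P g s =
  Σ (List (ℕ × ℕ)) λ Ls →
    Unique Ls × (∀ v → (v ∈ Ls) ⇔ P v) × sum (L.map g Ls) ≡ s

-- x ⊙ y : the element of [n] = {1..n} congruent to x*y mod n
odot : ℕ → ℕ → ℕ → ℕ
odot zero x y = zero
odot (suc m) x y with (x * y) % suc m
... | zero = suc m
... | suc r = suc r

data V (n : ℕ) : ℕ → ℕ → Set where
  base : ∀ {l} → 1 ≤ l → l < n → gcd l n ≡ 1 → V n 1 l
  step : ∀ {k l p} → V n k l → Prime p → p ∣ n → k * p ∣ n →
         V n (k * p) (odot n l p)

data Ψ (n : ℕ) : ℕ × ℕ → ℕ × ℕ → Set where
  edge : ∀ {k l p} → V n k l → Prime p → p ∣ n → k * p ∣ n →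
         Ψ n (k , l) (k * p , odot n l p)

Prec : ℕ → ℕ × ℕ → ℕ × ℕ → Set
Prec n = TransClosure (Ψ n)

-- membership of K_ξ in f(⟨k,l⟩) (stated for a representative ξ)
FMember : ∀ {n} → Perm n → ℕ → ℕ → Perm n → Set
FMember {n} σ k l ξ =
  (k < n × (σ ^ₚ k) · ξ ≡ ξ · (σ ^ₚ l) ×
     (∀ k₁ l₁ → 1 ≤ k₁ → k₁ < k → (σ ^ₚ k₁) · ξ ≢ ξ · (σ ^ₚ l₁)))
  ⊎ (k ≡ n × l ≡ n × ClassSize σ ξ (n * n))

-- n / k (only used for k ≥ 1, k ∣ n)
ndiv : ℕ → ℕ → ℕ
ndiv n zero = zero
ndiv n (suc k) = n / suc k

{-# OPTIONS --safe #-}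
-- Write [ k , l ] for the set of permutations ξ with σ^k ξ = ξ σ^l.  For fixed ξ the pairs (k , l)
-- with ξ ∈ [ k , l ] form a subgroup generated, modulo n in the second entry, by the pair ⟨ r , t ⟩
-- with r minimal; this pair satisfies gcd (t , n) = r, so it is a vertex, and the class of ξ consists
-- of the r n distinct permutations σ^i ξ σ^j with i < r, j < n.  Splitting [ k , l ] by minimal pair
-- therefore gives |[ k , l ]| = n (Σ r |f ⟨ r , t ⟩|), summed over ⟨ k , l ⟩ and all ⟨ r , t ⟩ ≺ ⟨ k , l ⟩.
-- On the other hand, if gcd (l , n) = k and n = m k, then identifying [n] with ℤ/n along σ, ξ ∈ [ k , l ]
-- is determined by k values which may be any numbers with distinct residues modulo k, so
-- |[ k , l ]| = k! m^k.
module Submission where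

open import Defs
open import Data.Empty using (⊥; ⊥-elim)
open import Data.Fin as Fin using (Fin; toℕ)
import Data.Fin.Properties as Fin
open import Data.List as List using (List; []; _∷_; length; map; filter; upTo; _++_; cartesianProduct)
open import Data.List.Membership.Propositional using (_∈_; find; lose)
open import Data.List.Membership.Propositional.Properties
  using (∈-map⁺; ∈-map⁻; ∈-filter⁺; ∈-filter⁻; ∈-upTo⁺; ∈-upTo⁻; ∈-++⁺ˡ; ∈-++⁺ʳ; ∈-++⁻; ∈-allFin;
         ∈-cartesianProduct⁺; ∈-cartesianProduct⁻)
open import Data.List.Membership.Propositional.Properties.WithK using (unique∧set⇒bag)
open import Data.List.Properties using (length-++; length-map; length-upTo; length-tabulate)
open import Data.List.Relation.Binary.BagAndSetEquality using (∼bag⇒↭)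
open import Data.List.Relation.Binary.Permutation.Propositional.Properties using (↭-length)
open import Data.List.Relation.Unary.All as All using (All; []; _∷_)
open import Data.List.Relation.Unary.All.Properties using (¬Any⇒All¬)
open import Data.List.Relation.Unary.AllPairs as AllPairs using (AllPairs; []; _∷_)
open import Data.List.Relation.Unary.Any as Any using (Any; here; there)
open import Data.List.Relation.Unary.Unique.Propositional using (Unique)
import Data.List.Relation.Unary.Unique.Propositional.Properties as Unique
open import Data.Nat using (ℕ; zero; suc; _+_; _*_; _∸_; _^_; _≤_; _<_; _/_; _%_; _!; NonZero; z≤n; s≤s;
  >-nonZero; >-nonZero⁻¹; ≢-nonZero; nonTrivial⇒n>1; nonTrivial⇒≢1)
open import Data.Nat.Coprimality using (Coprime; coprime-divisor; coprime⇒gcd≡1)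
open import Data.Nat.Divisibility
open import Data.Nat.DivMod
open import Data.Nat.GCD
open import Data.Nat.Induction using (<-rec)
open import Data.Nat.ListAction using (sum; product)
open import Data.Nat.Primality using (Prime; prime⇒nonTrivial; prime⇒irreducible)
open import Data.Nat.Primality.Factorisation using (factorise; PrimeFactorisation)
open import Data.Nat.Properties
open import Data.Nat.Solver using (module +-*-Solver)
open import Data.Product using (Σ; _×_; _,_; proj₁; proj₂; ∃)
open import Data.Sum using (_⊎_; inj₁; inj₂)
open import Data.Unit using (⊤; tt)
open import Data.Vec using (Vec; []; _∷_; lookup; tabulate)
open import Data.Vec.Properties
  using (lookup-map; lookup-allFin; lookup∘tabulate; map-lookup-allFin; tabulate∘lookup; tabulate-cong; ≡-dec)
open import Function.Bundles using (_⇔_; mk⇔; Equivalence)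
open import Relation.Binary.Construct.Closure.Transitive using ([_]; _∷_)
open import Relation.Binary.PropositionalEquality
  using (_≡_; _≢_; refl; sym; trans; cong; cong₂; subst; subst₂; module ≡-Reasoning)
open import Relation.Nullary using (¬_; Dec; yes; no)
open import Relation.Nullary.Decidable using (map′; _×-dec_; _→-dec_; ¬?)
open import Relation.Unary using (Decidable)
open +-*-Solver using (solve; _:+_; _:*_; _:=_; con)
open Equivalence using (to; from)

-- Cardinalities of predicates

-- The graph grows by one prime at a time, whereas the splitting sees only multiples: (k, l) is q(r,
-- t), with second entries taken modulo n. Two facts reconcile them. For n ≥ 2 every pair with gcd
-- (l , n) = k really is a vertex: l / k is a unit modulo n / k, it lifts to a unit u modulo n, and
-- from the base vertex ⟨ 1 , u ⟩ the primes of k lead to ⟨ k , l ⟩. And ⟨ r , t ⟩ ≺ ⟨ k , l ⟩ says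
-- exactly that ⟨ k , l ⟩ is a multiple of ⟨ r , t ⟩ with r < k, the path spelling out the primes of
-- q. For n = 1 there are no vertices at all. The two clauses defining f are one condition: a class
-- has n² elements exactly when its minimal pair has r = n, and then t = n as well. So `Minimal`
-- describes f at every vertex. Division is avoided by proving k |f| + s = (k - 1)! (n / k)^(k - 1),
-- with s the sum over the predecessors. This follows from n (k |f| + s) = k! m^k by cancelling n =
-- m k.

HasSize : {A : Set} → (A → Set) → ℕ → Set
HasSize {A} P m = Σ (List A) λ xs → Unique xs × (∀ x → (x ∈ xs) ⇔ P x) × length xs ≡ m

module _ {A : Set} where

  -- Duplicate-free lists with the same members are permutations of each other. Every double count
  -- below ends here.
  hasSize-unique : {P : A → Set} {m m′ : ℕ} → HasSize P m → HasSize P m′ → m ≡ m′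
  hasSize-unique (xs , uxs , mem , refl) (ys , uys , mem′ , refl) =
    ↭-length (∼bag⇒↭ (unique∧set⇒bag uxs uys
      λ {x} → mk⇔ (λ i → from (mem′ x) (to (mem x) i)) (λ i → from (mem x) (to (mem′ x) i))))

  hasSize-cong : {P Q : A → Set} {m : ℕ} → (∀ x → P x → Q x) → (∀ x → Q x → P x) →
                 HasSize P m → HasSize Q m
  hasSize-cong f g (xs , u , mem , e) =
    xs , u , (λ x → mk⇔ (λ i → f x (to (mem x) i)) (λ q → from (mem x) (g x q))) , e

  hasSize-filter : {P Q : A → Set} {m : ℕ} → Decidable Q → HasSize P m →
                   Σ ℕ λ m′ → HasSize (λ x → P x × Q x) m′
  hasSize-filter Q? (xs , u , mem , e) =
    length (filter Q? xs) , filter Q? xs , Unique.filter⁺ Q? u ,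
    (λ x → mk⇔ (λ i → let j , q = ∈-filter⁻ Q? i in to (mem x) j , q)
               (λ (p , q) → ∈-filter⁺ Q? (from (mem x) p) q)) , refl

  hasSize-empty : {P : A → Set} → (∀ x → ¬ P x) → HasSize P 0
  hasSize-empty ¬P = [] , [] , (λ x → mk⇔ (λ ()) (λ p → ⊥-elim (¬P x p))) , refl

  hasSize-singleton : (a : A) → HasSize (_≡ a) 1
  hasSize-singleton a =
    a ∷ [] , [] ∷ [] , (λ x → mk⇔ (λ { (here e) → e ; (there ()) }) here) , refl

  hasSize-⊎ : {P Q : A → Set} {m m′ : ℕ} → HasSize P m → HasSize Q m′ →
              (∀ x → P x → Q x → ⊥) → HasSize (λ x → P x ⊎ Q x) (m + m′)
  hasSize-⊎ {P} {Q} (xs , u , mem , refl) (ys , u′ , mem′ , refl) disj =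
    xs ++ ys ,
    Unique.++⁺ u u′ (λ {x} (i , j) → disj x (to (mem x) i) (to (mem′ x) j)) ,
    (λ x → mk⇔ (there⇒ x) (⇒there x)) ,
    length-++ xs
    where
    there⇒ : ∀ x → x ∈ xs ++ ys → P x ⊎ Q x
    there⇒ x i with ∈-++⁻ xs i
    ... | inj₁ j = inj₁ (to (mem x) j)
    ... | inj₂ j = inj₂ (to (mem′ x) j)
    ⇒there : ∀ x → P x ⊎ Q x → x ∈ xs ++ ys
    ⇒there x (inj₁ p) = ∈-++⁺ˡ (from (mem x) p)
    ⇒there x (inj₂ q) = ∈-++⁺ʳ xs (from (mem′ x) q)

module _ {A B : Set} where

  map-unique : (f : A → B) (xs : List A) →
               (∀ {x y} → x ∈ xs → y ∈ xs → f x ≡ f y → x ≡ y) →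
               Unique xs → Unique (map f xs)
  map-unique f [] inj [] = []
  map-unique f (x ∷ xs) inj (x∉xs ∷ u) =
    All.tabulate distinct ∷ map-unique f xs (λ i j → inj (there i) (there j)) u
    where
    distinct : ∀ {y} → y ∈ map f xs → f x ≢ y
    distinct i e with ∈-map⁻ f i
    ... | z , z∈xs , refl = All.lookup x∉xs z∈xs (inj (here refl) (there z∈xs) e)

  hasSize-image : {P : A → Set} {Q : B → Set} {m : ℕ} (f : A → B) →
                  (∀ {x y} → P x → P y → f x ≡ f y → x ≡ y) →
                  (∀ {x} → P x → Q (f x)) →
                  (∀ {y} → Q y → ∃ λ x → P x × f x ≡ y) →
                  HasSize P m → HasSize Q m
  hasSize-image {P} {Q} f inj img onto (xs , u , mem , e) =
    map f xs ,
    map-unique f xs (λ i j → inj (to (mem _) i) (to (mem _) j)) u ,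
    (λ y → mk⇔ (⇒Q y) (Q⇒ y)) ,
    trans (length-map f xs) e
    where
    ⇒Q : ∀ y → y ∈ map f xs → Q y
    ⇒Q y i with ∈-map⁻ f i
    ... | x , x∈xs , refl = img (to (mem x) x∈xs)
    Q⇒ : ∀ y → Q y → y ∈ map f xs
    Q⇒ y q with onto q
    ... | x , p , refl = ∈-map⁺ f (from (mem x) p)

  hasSize-⋃ : (F : A → B → Set) (w : A → ℕ) (is : List A) →
              All (λ i → HasSize (F i) (w i)) is →
              AllPairs (λ i j → ∀ b → F i b → F j b → ⊥) is →
              HasSize (λ b → Any (λ i → F i b) is) (sum (map w is))
  hasSize-⋃ F w [] [] [] = hasSize-empty (λ b ())
  hasSize-⋃ F w (i ∷ is) (s ∷ ss) (d ∷ ds) =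
    hasSize-cong (λ b → λ { (inj₁ p) → here p ; (inj₂ q) → there q })
                 (λ b → λ { (here p) → inj₁ p ; (there q) → inj₂ q })
                 (hasSize-⊎ s (hasSize-⋃ F w is ss ds) (λ b p q → apart d b p q))
    where
    apart : ∀ {js} → All (λ j → ∀ b → F i b → F j b → ⊥) js →
            ∀ b → F i b → Any (λ j → F j b) js → ⊥
    apart (e ∷ _)  b p (here q)  = e b p q
    apart (_ ∷ es) b p (there q) = apart es b p q

  sum-const : (w : ℕ) (xs : List A) → sum (map (λ _ → w) xs) ≡ length xs * w
  sum-const w []       = refl
  sum-const w (_ ∷ xs) = cong (w +_) (sum-const w xs)

  hasSize-Σ : {P : A → Set} {m w : ℕ} (F : A → B → Set) → HasSize P m →
              (∀ i → P i → HasSize (F i) w) →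
              (∀ i j b → P i → P j → F i b → F j b → i ≡ j) →
              HasSize (λ b → ∃ λ i → P i × F i b) (m * w)
  hasSize-Σ {P} {m} {w} F (is , u , mem , refl) sizes disj =
    hasSize-cong ⇒Σ Σ⇒
      (subst (HasSize _) (sum-const w is)
        (hasSize-⋃ (λ i b → P i × F i b) (λ _ → w) is
          (All.tabulate λ {i} i∈is → hasSize-cong (λ b p → to (mem i) i∈is , p) (λ b → proj₂)
            (sizes i (to (mem i) i∈is)))
          (AllPairs.map (λ {i} {j} i≢j b (p , f) (p′ , f′) → i≢j (disj i j b p p′ f f′)) u)))
    where
    ⇒Σ : ∀ b → Any (λ i → P i × F i b) is → ∃ λ i → P i × F i b
    ⇒Σ b any with find any
    ... | i , i∈is , p = i , p
    Σ⇒ : ∀ b → (∃ λ i → P i × F i b) → Any (λ i → P i × F i b) is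
    Σ⇒ b (i , p , f) = lose (from (mem i) p) (p , f)

hasSize-< : ∀ n → HasSize (_< n) n
hasSize-< n = upTo n , Unique.upTo⁺ n , (λ x → mk⇔ ∈-upTo⁻ ∈-upTo⁺) , length-upTo n

module _ {A : Set} (_≈_ : A → A → Set) (_≈?_ : ∀ x y → Dec (x ≈ y))
         (≈-refl : ∀ x → x ≈ x) where

  -- An element is kept only if it is related to no representative chosen from the elements after
  -- it. The representatives are therefore apart in list order, which is the form that `NumClasses`
  -- asks for.
  representatives : (xs : List A) → Σ (List A) λ rs →
    All (_∈ xs) rs × AllPairs (λ x y → ¬ (x ≈ y)) rs × (∀ {x} → x ∈ xs → Any (x ≈_) rs)
  representatives [] = [] , [] , [] , λ ()
  representatives (x ∷ xs) with representatives xs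
  ... | rs , rs⊆xs , apart , cover with Any.any? (x ≈?_) rs
  ...   | yes x≈rs = rs , All.map there rs⊆xs , apart ,
                     λ { (here refl) → x≈rs ; (there i) → cover i }
  ...   | no  x≉rs = x ∷ rs , here refl ∷ All.map there rs⊆xs , ¬Any⇒All¬ rs x≉rs ∷ apart ,
                     λ { (here refl) → here (≈-refl x) ; (there i) → there (cover i) }

sum-map-scale : ∀ {A : Set} (n : ℕ) (g w : A → ℕ) → (∀ x → w x ≡ n * g x) → ∀ xs → sum (map w xs) ≡ n * sum (map g xs)
sum-map-scale n g w e []       = sym (*-zeroʳ n)
sum-map-scale n g w e (x ∷ xs) =
  trans (cong₂ _+_ (e x) (sum-map-scale n g w e xs)) (sym (*-distribˡ-+ n (g x) (sum (map g xs))))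

-- Congruences and the vertices of Γₙ

∣-cancelʳ-+ : ∀ {d a b} → d ∣ a + b → d ∣ b → d ∣ a
∣-cancelʳ-+ {d} {a} {b} d∣a+b d∣b = ∣m+n∣m⇒∣n (subst (d ∣_) (+-comm a b) d∣a+b) d∣b

-- Congruence without subtraction; a record, so that x and y can be inferred.
record Cong (n x y : ℕ) : Set where
  constructor congruent
  field
    {u v} : ℕ
    equal : x + u * n ≡ y + v * n

module _ {n : ℕ} where

  cong-reflexive : ∀ {x y} → x ≡ y → Cong n x y
  cong-reflexive refl = congruent {u = 0} {0} refl

  cong-refl : ∀ {x} → Cong n x x
  cong-refl = cong-reflexive refl

  cong-sym : ∀ {x y} → Cong n x y → Cong n y x
  cong-sym (congruent {u} {v} e) = congruent {u = v} {u} (sym e)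

  cong-trans : ∀ {x y z} → Cong n x y → Cong n y z → Cong n x z
  cong-trans {x} {y} {z} (congruent {u} {v} e) (congruent {u′} {v′} e′) = congruent {u = u + u′} {v′ + v} (begin
    x + (u + u′) * n      ≡⟨ solve 4 (λ x u u′ n → x :+ (u :+ u′) :* n := (x :+ u :* n) :+ u′ :* n) refl x u u′ n ⟩
    (x + u * n) + u′ * n  ≡⟨ cong (_+ u′ * n) e ⟩
    (y + v * n) + u′ * n  ≡⟨ solve 4 (λ y v u′ n → (y :+ v :* n) :+ u′ :* n := (y :+ u′ :* n) :+ v :* n) refl y v u′ n ⟩
    (y + u′ * n) + v * n  ≡⟨ cong (_+ v * n) e′ ⟩
    (z + v′ * n) + v * n  ≡⟨ solve 4 (λ z v v′ n → (z :+ v′ :* n) :+ v :* n := z :+ (v′ :+ v) :* n) refl z v v′ n ⟩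
    z + (v′ + v) * n      ∎)
    where open ≡-Reasoning

  cong-+ : ∀ {x y x′ y′} → Cong n x y → Cong n x′ y′ → Cong n (x + x′) (y + y′)
  cong-+ {x} {y} {x′} {y′} (congruent {u} {v} e) (congruent {u′} {v′} e′) = congruent {u = u + u′} {v + v′} (begin
    x + x′ + (u + u′) * n        ≡⟨ lem x x′ u u′ n ⟩
    (x + u * n) + (x′ + u′ * n)  ≡⟨ cong₂ _+_ e e′ ⟩
    (y + v * n) + (y′ + v′ * n)  ≡⟨ lem y y′ v v′ n ⟨
    y + y′ + (v + v′) * n        ∎)
    where
    open ≡-Reasoning
    lem : ∀ x x′ u u′ n → x + x′ + (u + u′) * n ≡ (x + u * n) + (x′ + u′ * n)
    lem = solve 5 (λ x x′ u u′ n → x :+ x′ :+ (u :+ u′) :* n := (x :+ u :* n) :+ (x′ :+ u′ :* n)) refl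

  cong-cancelʳ : ∀ {x y} z → Cong n (x + z) (y + z) → Cong n x y
  cong-cancelʳ {x} {y} z (congruent {u} {v} e) = congruent {u = u} {v} (+-cancelʳ-≡ z _ _ (begin
    x + u * n + z  ≡⟨ lem x (u * n) z ⟩
    x + z + u * n  ≡⟨ e ⟩
    y + z + v * n  ≡⟨ lem y (v * n) z ⟨
    y + v * n + z  ∎))
    where
    open ≡-Reasoning
    lem : ∀ x w z → x + w + z ≡ x + z + w
    lem = solve 3 (λ x w z → x :+ w :+ z := x :+ z :+ w) refl

  cong-*ʳ : ∀ {x y} z → Cong n x y → Cong n (x * z) (y * z)
  cong-*ʳ {x} {y} z (congruent {u} {v} e) = congruent {u = u * z} {v * z} (begin
    x * z + u * z * n  ≡⟨ lem x u z n ⟩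
    (x + u * n) * z    ≡⟨ cong (_* z) e ⟩
    (y + v * n) * z    ≡⟨ lem y v z n ⟨
    y * z + v * z * n  ∎)
    where
    open ≡-Reasoning
    lem : ∀ x u z n → x * z + u * z * n ≡ (x + u * n) * z
    lem = solve 4 (λ x u z n → x :* z :+ u :* z :* n := (x :+ u :* n) :* z) refl

  cong-multiple : ∀ q → Cong n (q * n) 0
  cong-multiple q = congruent {u = 0} {q} (+-identityʳ (q * n))

  -- Multiplication by n - 1 is negation modulo n; negative exponents of `σ` are written this way
  -- below.
  cong-neg : ∀ x → .{{_ : NonZero n}} → Cong n (x + x * (n ∸ 1)) 0
  cong-neg x = cong-trans (cong-reflexive (begin
    x + x * (n ∸ 1)  ≡⟨ *-suc x (n ∸ 1) ⟨
    x * suc (n ∸ 1)  ≡⟨ cong (x *_) (suc-pred n) ⟩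
    x * n            ∎)) (cong-multiple x)
    where open ≡-Reasoning

  ∣⇒cong : ∀ {x} → n ∣ x → Cong n x 0
  ∣⇒cong (divides q e) = cong-trans (cong-reflexive e) (cong-multiple q)

  cong-∣ : ∀ {d x y} → d ∣ n → Cong n x y → d ∣ x → d ∣ y
  cong-∣ {d} {x} {y} d∣n (congruent {u} {v} e) d∣x =
    ∣-cancelʳ-+ (subst (d ∣_) e (∣m∣n⇒∣m+n d∣x (∣n⇒∣m*n u d∣n))) (∣n⇒∣m*n v d∣n)

  cong⇒∣ : ∀ {x} → Cong n x 0 → n ∣ x
  cong⇒∣ c = cong-∣ ∣-refl (cong-sym c) (n ∣0)

  cong-self : Cong n n 0
  cong-self = ∣⇒cong ∣-refl

  cong-gcd : ∀ {x y} → Cong n x y → gcd x n ≡ gcd y n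
  cong-gcd c = ∣-antisym (half c) (half (cong-sym c))
    where
    half : ∀ {x y} → Cong n x y → gcd x n ∣ gcd y n
    half {x} c = gcd-greatest (cong-∣ (gcd[m,n]∣n x n) c (gcd[m,n]∣m x n)) (gcd[m,n]∣n x n)

  module _ .{{_ : NonZero n}} where

    cong⇒% : ∀ {x y} → Cong n x y → x % n ≡ y % n
    cong⇒% {x} {y} (congruent {u} {v} e) = begin
      x % n            ≡⟨ [m+kn]%n≡m%n x u n ⟨
      (x + u * n) % n  ≡⟨ cong (_% n) e ⟩
      (y + v * n) % n  ≡⟨ [m+kn]%n≡m%n y v n ⟩
      y % n            ∎
      where open ≡-Reasoning

    cong-% : ∀ x → Cong n x (x % n)
    cong-% x = congruent {u = 0} {x / n} (trans (+-identityʳ x) (m≡m%n+[m/n]*n x n))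

    %⇒cong : ∀ {x y} → x % n ≡ y % n → Cong n x y
    %⇒cong {x} {y} e = cong-trans (cong-% x) (cong-trans (cong-reflexive e) (cong-sym (cong-% y)))

    cong? : ∀ x y → Dec (Cong n x y)
    cong? x y = map′ %⇒cong cong⇒% (x % n ≟ y % n)

    cong-<⇒≡ : ∀ {x y} → x < n → y < n → Cong n x y → x ≡ y
    cong-<⇒≡ x<n y<n c = trans (sym (m<n⇒m%n≡m x<n)) (trans (cong⇒% c) (m<n⇒m%n≡m y<n))

    cong-range⇒≡ : ∀ {x y} → 1 ≤ x → x ≤ n → 1 ≤ y → y ≤ n → Cong n x y → x ≡ y
    cong-range⇒≡ {suc x} {suc y} _ x≤n _ y≤n c =
      cong suc (cong-<⇒≡ x≤n y≤n (cong-cancelʳ 1 (cong-trans (cong-reflexive (+-comm x 1))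
                                   (cong-trans c (cong-reflexive (+-comm 1 y))))))

    -- Second entries of vertices lie in 1, ..., n, so the residue 0 is represented by n and not by
    -- 0.
    range : ∀ x → ∃ λ y → 1 ≤ y × y ≤ n × Cong n y x
    range x with x % n in e
    ... | zero  = n , >-nonZero⁻¹ n , ≤-refl ,
                  %⇒cong (trans (n%n≡0 n) (sym e))
    ... | suc r = suc r , s≤s z≤n , <⇒≤ r<n , %⇒cong (trans (m<n⇒m%n≡m r<n) (sym e))
      where
      r<n : suc r < n
      r<n = subst (_< n) e (m%n<n x n)

cong-weaken : ∀ {d n x y} → d ∣ n → Cong n x y → Cong d x y
cong-weaken {d} {n} {x} {y} (divides q refl) (congruent {u} {v} e) =
  congruent {u = u * q} {v * q} (trans (cong (x +_) (*-assoc u q d)) (trans e (cong (y +_) (sym (*-assoc v q d)))))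

-- Arithmetic description of the vertices and of ≺

odot-range : ∀ n .{{_ : NonZero n}} x y →
             1 ≤ odot n x y × odot n x y ≤ n × Cong n (odot n x y) (x * y)
odot-range n@(suc m) x y with (x * y) % n in e
... | zero  = s≤s z≤n , ≤-refl , %⇒cong (trans (n%n≡0 n) (sym e))
... | suc r = s≤s z≤n , <⇒≤ r<n , %⇒cong (trans (m<n⇒m%n≡m r<n) (sym e))
  where
  r<n : suc r < n
  r<n = subst (_< n) e (m%n<n (x * y) n)

-- Closed form of `V` for n ≥ 2, by `V⇒isVertex` and `isVertex⇒V`; the second entry determines the
-- first.
IsVertex : ℕ → ℕ → ℕ → Set
IsVertex n k l = 1 ≤ l × l ≤ n × gcd l n ≡ k

module _ (n : ℕ) .{{_ : NonZero n}} where

  -- The invariant gcd (l , n) = k survives a step: gcd (l p , n) divides gcd (l p , n p) = k p, and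
  -- k p divides both l p and n, the latter being the condition of the step.
  V⇒isVertex : ∀ {k l} → V n k l → IsVertex n k l
  V⇒isVertex (base 1≤l l<n g) = 1≤l , <⇒≤ l<n , g
  V⇒isVertex (step {k} {l} {p} v _ _ kp∣n) with V⇒isVertex v | odot-range n l p
  ... | _ , _ , refl | lo , hi , c = lo , hi , trans (cong-gcd c) (∣-antisym below above)
    where
    below : gcd (l * p) n ∣ gcd l n * p
    below = subst (gcd (l * p) n ∣_)
      (trans (cong₂ gcd (*-comm l p) (*-comm n p)) (trans (sym (c*gcd[m,n]≡gcd[cm,cn] p l n)) (*-comm p _)))
      (gcd-greatest (gcd[m,n]∣m (l * p) n) (∣m⇒∣m*n p (gcd[m,n]∣n (l * p) n)))
    above : gcd l n * p ∣ gcd (l * p) n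
    above = gcd-greatest (*-monoˡ-∣ p (gcd[m,n]∣m l n)) kp∣n

  vertex-∣ : ∀ {k l} → IsVertex n k l → k ∣ n
  vertex-∣ {l = l} (_ , _ , refl) = gcd[m,n]∣n l n

  vertex-pos : ∀ {k l} → IsVertex n k l → 1 ≤ k
  vertex-pos {k} {l} v = n≢0⇒n>0 λ { refl → >⇒≢ (>-nonZero⁻¹ n) (0∣⇒≡0 (vertex-∣ v)) }

  Reach : ℕ × ℕ → ℕ × ℕ → Set
  Reach v w = v ≡ w ⊎ Prec n v w

  -- One edge per prime of the list. Each intermediate first entry divides k′, hence n, so the rule
  -- always applies. Second entries are followed only modulo n; the range 1, ..., n pins down the
  -- last one. The empty list is the reason why `Reach` allows equality.
  multiply-path : ∀ ps {k l k′ l′} → All Prime ps → V n k l →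
    k′ ≡ k * product ps → k′ ∣ n → 1 ≤ l′ → l′ ≤ n → Cong n l′ (l * product ps) →
    V n k′ l′ × Reach (k , l) (k′ , l′)
  multiply-path [] {k} {l} [] v e k′∣n lo hi c
    with refl ← trans e (*-identityʳ k)
    with lo₁ , hi₁ , _ ← V⇒isVertex v
    with refl ← cong-range⇒≡ lo hi lo₁ hi₁ (cong-trans c (cong-reflexive (*-identityʳ l)))
    = v , inj₁ refl
  multiply-path (p ∷ ps) {k} {l} (pp ∷ pps) v refl k′∣n lo hi c
    = proj₁ rec , inj₂ (reach (proj₂ rec))
    where
    kp∣n : k * p ∣ n
    kp∣n = ∣-trans (subst (k * p ∣_) (*-assoc k p (product ps)) (m∣m*n (product ps))) k′∣n
    p∣n : p ∣ n
    p∣n = ∣-trans (n∣m*n k) kp∣n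
    rec = multiply-path ps pps (step v pp p∣n kp∣n) (sym (*-assoc k p (product ps))) k′∣n lo hi
      (cong-trans c (cong-trans (cong-reflexive (sym (*-assoc l p (product ps))))
        (cong-*ʳ (product ps) (cong-sym (proj₂ (proj₂ (odot-range n l p)))))))
    reach : ∀ {w} → Reach (k * p , odot n l p) w → Prec n (k , l) w
    reach (inj₁ refl) = [ edge v pp p∣n kp∣n ]
    reach (inj₂ path) = edge v pp p∣n kp∣n ∷ path

-- A common divisor of u and p m is coprime to m because it divides u; so it divides p.
prime-coprime : ∀ {p u m} → Prime p → ¬ p ∣ u → Coprime u m → Coprime u (p * m)
prime-coprime {p} {u} {m} pp p∤u cop {d} (d∣u , d∣pm) with prime⇒irreducible pp d∣p
  where
  d∣p : d ∣ p
  d∣p = coprime-divisor (λ (e∣d , e∣m) → cop (∣-trans e∣d d∣u , e∣m)) (subst (d ∣_) (*-comm p m) d∣pm)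
... | inj₁ d≡1 = d≡1
... | inj₂ refl = ⊥-elim (p∤u d∣u)

-- Units modulo m lift to units modulo any multiple of m, one prime at a time.
lift-unit : ∀ ps {t m} → All Prime ps → Coprime t m →
            ∃ λ u → Cong m u t × Coprime u (product ps * m)
lift-unit [] {t} {m} [] cop = t , cong-reflexive refl , subst (Coprime t) (sym (*-identityˡ m)) cop
lift-unit (p ∷ ps) {t} {m} (pp ∷ pps) cop = lifted (p ∣? t)
  where
  finish : ∀ {t′} → Cong m t′ t → Coprime t′ (p * m) →
           ∃ λ u → Cong m u t × Coprime u (p * product ps * m)
  finish c cop′ with lift-unit ps pps cop′
  ... | u , c′ , cop″ = u , cong-trans (cong-weaken (n∣m*n p) c′) c ,
    subst (Coprime u) (lem p (product ps) m) cop″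
    where
    lem : ∀ p q m → q * (p * m) ≡ p * q * m
    lem = solve 3 (λ p q m → q :* (p :* m) := p :* q :* m) refl
  lifted : Dec (p ∣ t) → ∃ λ u → Cong m u t × Coprime u (p * product ps * m)
  lifted (no p∤t)  = finish cong-refl (prime-coprime pp p∤t cop)
  -- As t and m are coprime, p does not divide m; so p does not divide t + m, which is still t
  -- modulo m.
  lifted (yes p∣t) = finish {t + m} (congruent {u = 0} {1} (trans (+-identityʳ _) (cong (t +_) (sym (*-identityˡ m)))))
    (prime-coprime pp p∤t+m λ (d∣t+m , d∣m) → cop (∣-cancelʳ-+ d∣t+m d∣m , d∣m))
    where
    p∤t+m : ¬ p ∣ t + m
    p∤t+m p∣t+m = nonTrivial⇒≢1 {{prime⇒nonTrivial pp}} (cop (p∣t , ∣m+n∣m⇒∣n p∣t+m p∣t))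

cong-scale : ∀ k {m x y} → Cong m x y → Cong (m * k) (x * k) (y * k)
cong-scale k {m} {x} {y} (congruent {u} {v} e) = congruent {u = u} {v} (trans (lem x u) (trans (cong (_* k) e) (sym (lem y v))))
  where
  lem : ∀ x u → x * k + u * (m * k) ≡ (x + u * m) * k
  lem x u = solve 4 (λ x u m k → x :* k :+ u :* (m :* k) := (x :+ u :* m) :* k) refl x u m k

gcd-quotients-coprime : ∀ {t m k} → .{{_ : NonZero k}} → gcd (t * k) (m * k) ≡ k → Coprime t m
gcd-quotients-coprime {t} {m} {k} g {d} (d∣t , d∣m) =
  ∣1⇒≡1 (*-cancelʳ-∣ k (subst (d * k ∣_) (trans g (sym (*-identityˡ k)))
    (gcd-greatest (*-monoˡ-∣ k d∣t) (*-monoˡ-∣ k d∣m))))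

module _ (n : ℕ) .{{_ : NonZero n}} where

  -- Write n = m k and l = t k. The unit t modulo m lifts to a unit u modulo n, and multiplying ⟨ 1
  -- , u ⟩ by the primes of k ends at ⟨ k , l ⟩, since u ≡ t modulo m gives u k ≡ l modulo n.
  isVertex⇒V : ∀ {k l} → 2 ≤ n → IsVertex n k l → V n k l
  isVertex⇒V {k} {l} 2≤n vert@(lo , hi , g) = from-unit (vertex-∣ n vert) (subst (_∣ l) g (gcd[m,n]∣m l n))
    where
    instance
      k≢0 : NonZero k
      k≢0 = >-nonZero (vertex-pos n vert)
    open PrimeFactorisation (factorise k) renaming (factors to ps)
    from-unit : k ∣ n → k ∣ l → V n k l
    from-unit (divides m refl) (divides t refl)
      with u , u≈t , cop ← lift-unit ps factorsPrime (gcd-quotients-coprime {t} {m} g)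
      with u′ , lo′ , hi′ , u′≈u ← range u
      = proj₁ (multiply-path n ps factorsPrime (base lo′ (≤∧≢⇒< hi′ u′≢n) gcd≡1)
                (trans isFactorisation (sym (*-identityˡ _))) (n∣m*n m) lo hi
                (cong-trans (cong-sym (cong-scale k (cong-trans (cong-weaken (m∣m*n k) u′≈u) u≈t)))
                            (cong-reflexive (cong (u′ *_) isFactorisation))))
      where
      gcd≡1 : gcd u′ n ≡ 1
      gcd≡1 = trans (cong-gcd u′≈u) (coprime⇒gcd≡1
                (subst (Coprime u) (trans (cong (_* m) (sym isFactorisation)) (*-comm k m)) cop))
      -- The base rule wants u′ < n strictly; u′ = n would have gcd n with n, which is not 1 for n ≥
      -- 2.
      u′≢n : u′ ≢ n
      u′≢n e = >⇒≢ 2≤n (∣1⇒≡1 (subst (n ∣_) gcd≡1 (gcd-greatest (subst (n ∣_) (sym e) ∣-refl) ∣-refl)))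

  -- Arithmetic form of ≺ between vertices; r < k accounts for the positive length of the path.
  Below : ℕ × ℕ → ℕ × ℕ → Set
  Below (r , t) (k , l) = r < k × ∃ λ q → k ≡ r * q × Cong n l (t * q)

  Ψ⇒below : ∀ {v w} → Ψ n v w → Below v w
  Ψ⇒below (edge {k} {l} {p} v pp _ kp∣n) =
    m<m*n k p (nonTrivial⇒n>1 p) , p , refl , proj₂ (proj₂ (odot-range n l p))
    where
    instance
      _ = prime⇒nonTrivial pp
      _ = >-nonZero (vertex-pos n (V⇒isVertex n v))

  prec⇒below : ∀ {v w} → Prec n v w → Below v w
  prec⇒below [ e ] = Ψ⇒below e
  prec⇒below {r , t} (e ∷ path) with Ψ⇒below e | prec⇒below path
  ... | r<r′ , q , refl , c | r′<k , q′ , refl , c′ =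
    <-trans r<r′ r′<k , q * q′ , *-assoc r q q′ ,
    cong-trans c′ (cong-trans (cong-*ʳ q′ c) (cong-reflexive (*-assoc t q q′)))

  prec-source : ∀ {r t w} → Prec n (r , t) w → V n r t
  prec-source [ edge v _ _ _ ]   = v
  prec-source (edge v _ _ _ ∷ _) = v

  -- The path multiplies by the prime factors of q in turn; r < k rules out the empty path.
  below⇒prec : ∀ {r t k l} → V n r t → V n k l → Below (r , t) (k , l) → Prec n (r , t) (k , l)
  below⇒prec {r} {t} {k} {l} v w (r<k , q , k≡rq , c)
    with lo , hi , _ ← V⇒isVertex n w
    with proj₂ (multiply-path n ps factorsPrime v (trans k≡rq (cong (r *_) isFactorisation))
      (vertex-∣ n (V⇒isVertex n w)) lo hi (cong-trans c (cong-reflexive (cong (t *_) isFactorisation))))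
    where
    instance
      q≢0 : NonZero q
      q≢0 = ≢-nonZero λ { refl → m<n⇒n≢0 r<k (trans k≡rq (*-zeroʳ r)) }
    open PrimeFactorisation (factorise q) renaming (factors to ps)
  ... | inj₁ refl = ⊥-elim (<-irrefl refl r<k)
  ... | inj₂ path = path

  below? : ∀ v w → Dec (Below v w)
  below? (r , t) (k , l) = map′ widen narrow
    ((r <? k) ×-dec anyUpTo? (λ q → (k ≟ r * q) ×-dec cong? l (t * q)) (suc k))
    where
    P : ℕ → Set
    P q = k ≡ r * q × Cong n l (t * q)
    widen : r < k × (∃ λ q → q < suc k × P q) → Below (r , t) (k , l)
    widen (r<k , q , _ , p) = r<k , q , p
    narrow : Below (r , t) (k , l) → r < k × (∃ λ q → q < suc k × P q)
    -- Since k = r q with r positive, q ≤ k, so a bounded search suffices.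
    narrow (r<k , q , e , c) = r<k , q , s≤s (subst (q ≤_) (sym e) (m≤n*m q r {{r≢0}})) , e , c
      where
      r≢0 : NonZero r
      r≢0 = ≢-nonZero λ { refl → m<n⇒n≢0 r<k e }

isVertex? : ∀ n k l → Dec (IsVertex n k l)
isVertex? n k l = (1 ≤? l) ×-dec ((l ≤? n) ×-dec (gcd l n ≟ k))

-- Every vertex descends from some ⟨ 1 , l ⟩ with 1 ≤ l < n.
V⇒2≤n : ∀ {n k l} → V n k l → 2 ≤ n
V⇒2≤n (base 1≤l l<n _) = ≤-<-trans 1≤l l<n
V⇒2≤n (step v _ _ _)   = V⇒2≤n v

vertex-top : ∀ {n l} → IsVertex n n l → l ≡ n
vertex-top {n} {l} (lo , hi , g) =
  ≤-antisym hi (∣⇒≤ {{>-nonZero lo}} (subst (_∣ l) g (gcd[m,n]∣m l n)))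

-- The sum over ≺ needs an explicit list. Both entries of a predecessor are at most n, and inside
-- this box ≺ is decided through `IsVertex` and `Below`.
predecessors : ∀ n .{{_ : NonZero n}} {k l} → V n k l → ∃ λ p → HasSize (λ v → Prec n v (k , l)) p
predecessors n {k} {l} kl =
  let p , s = hasSize-filter (λ (r , t) → isVertex? n r t ×-dec below? n (r , t) (k , l)) box in
  p , hasSize-cong (λ (r , t) (_ , v , b) → below⇒prec n (isVertex⇒V n (V⇒2≤n kl) v) kl b) bounded s
  where
  Box : ℕ × ℕ → Set
  Box (r , t) = r < suc n × t < suc n
  box : HasSize Box (length (cartesianProduct (upTo (suc n)) (upTo (suc n))))
  box = _ , Unique.cartesianProduct⁺ (Unique.upTo⁺ (suc n)) (Unique.upTo⁺ (suc n)) ,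
    (λ v → mk⇔ (λ i → let x , y = ∈-cartesianProduct⁻ (upTo (suc n)) (upTo (suc n)) i in ∈-upTo⁻ x , ∈-upTo⁻ y)
               (λ (x , y) → ∈-cartesianProduct⁺ (∈-upTo⁺ x) (∈-upTo⁺ y))) , refl
  bounded : ∀ v → Prec n v (k , l) → Box v × IsVertex n (proj₁ v) (proj₂ v) × Below n v (k , l)
  bounded (r , t) path with vert@(_ , hi , _) ← V⇒isVertex n (prec-source n path) =
    (s≤s (∣⇒≤ (vertex-∣ n vert)) , s≤s hi) , vert , prec⇒below n path

numClasses-cong : ∀ {n} {σ : Perm n} {P Q : Perm n → Set} {c} →
  (∀ ξ → IsPerm ξ → P ξ → Q ξ) → (∀ ξ → IsPerm ξ → Q ξ → P ξ) → NumClasses σ P c → NumClasses σ Q c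
numClasses-cong f g (xs , len , all , apart , cover) =
  xs , len , All.map (λ {ξ} (pξ , p) → pξ , f ξ pξ p) all , apart , λ ξ pξ q → cover ξ pξ (g ξ pξ q)

-- Sequences with distinct residues

hasSize-Fin : ∀ n → HasSize {Fin n} (λ _ → ⊤) n
hasSize-Fin n = List.allFin n , Unique.allFin⁺ n , (λ i → mk⇔ (λ _ → tt) (λ _ → ∈-allFin i)) , length-tabulate (λ i → i)

module Residues (k m : ℕ) .{{_ : NonZero k}} where

  Free : ∀ {j} → Vec ℕ j → ℕ → Set
  Free v ρ = ∀ i → ρ ≢ lookup v i % k

  DistinctResidues : ∀ {j} → Vec ℕ j → Set
  DistinctResidues v = ∀ i i′ → lookup v i % k ≡ lookup v i′ % k → i ≡ i′

  Sequence : ∀ {j} → Vec ℕ j → Set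
  Sequence v = (∀ i → lookup v i < m * k) × DistinctResidues v

  residue-class-size : ∀ ρ → ρ < k → HasSize (λ x → x < m * k × x % k ≡ ρ) m
  residue-class-size ρ ρ<k = hasSize-image (λ q → ρ + q * k)
    (λ {q} {q′} _ _ e → *-cancelʳ-≡ q q′ k (+-cancelˡ-≡ ρ _ _ e))
    (λ {q} q<m → <-≤-trans (+-monoˡ-< (q * k) ρ<k) (*-monoˡ-≤ k q<m) ,
                 trans ([m+kn]%n≡m%n ρ q k) (m<n⇒m%n≡m ρ<k))
    (λ {x} (x<mk , e) → x / k , m<n*o⇒m/o<n x<mk ,
                        trans (cong (_+ x / k * k) (sym e)) (sym (m≡m%n+[m/n]*n x k)))
    (hasSize-< m)

  free-size : ∀ {j} (v : Vec ℕ j) → DistinctResidues v → HasSize (λ ρ → ρ < k × Free v ρ) (k ∸ j)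
  free-size {j} v distinct = subst (HasSize _) c≡k∸j (proj₂ free)
    where
    Used : ℕ → Set
    Used ρ = ∃ λ i → lookup v i % k ≡ ρ
    used? : ∀ ρ → Dec (Used ρ)
    used? ρ = Fin.any? λ i → lookup v i % k ≟ ρ
    used : HasSize Used j
    used = hasSize-image (λ i → lookup v i % k) (λ {i} {i′} _ _ → distinct i i′)
      (λ {i} _ → i , refl) (λ (i , e) → i , tt , e) (hasSize-Fin j)
    free : Σ ℕ λ c → HasSize (λ ρ → ρ < k × Free v ρ) c
    free = let c , s = hasSize-filter (λ ρ → ¬? (used? ρ)) (hasSize-< k) in
      c , hasSize-cong (λ ρ (ρ<k , u) → ρ<k , λ i e → u (i , sym e))
                       (λ ρ (ρ<k , f) → ρ<k , λ (i , e) → f i (sym e)) s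
    split : ∀ ρ → ρ < k → Used ρ ⊎ (ρ < k × Free v ρ)
    split ρ ρ<k with used? ρ
    ... | yes u = inj₁ u
    ... | no ¬u = inj₂ (ρ<k , λ i e → ¬u (i , sym e))
    merge : ∀ ρ → Used ρ ⊎ (ρ < k × Free v ρ) → ρ < k
    merge ρ (inj₁ (i , e)) = subst (_< k) e (m%n<n (lookup v i) k)
    merge ρ (inj₂ (ρ<k , _)) = ρ<k
    j+c≡k : j + proj₁ free ≡ k
    j+c≡k = hasSize-unique
      (hasSize-cong merge split (hasSize-⊎ used (proj₂ free) (λ ρ (i , e) (_ , f) → f i (sym e))))
      (hasSize-< k)
    c≡k∸j : proj₁ free ≡ k ∸ j
    c≡k∸j = trans (sym (m+n∸m≡n j (proj₁ free))) (cong (_∸ j) j+c≡k)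

  extension-size : ∀ {j} (v : Vec ℕ j) → DistinctResidues v →
                   HasSize (λ x → x < m * k × Free v (x % k)) ((k ∸ j) * m)
  extension-size v distinct = hasSize-cong
    (λ x (ρ , (_ , f) , x<mk , e) → x<mk , subst (Free v) (sym e) f)
    (λ x (x<mk , f) → x % k , (m%n<n x k , f) , x<mk , refl)
    (hasSize-Σ (λ ρ x → x < m * k × x % k ≡ ρ) (free-size v distinct)
      (λ ρ (ρ<k , _) → residue-class-size ρ ρ<k)
      (λ ρ ρ′ x _ _ (_ , e) (_ , e′) → trans (sym e) e′))

  -- To prepend a value, choose one of the k - j residues still free, then one of the m numbers
  -- below m k with that residue.
  #sequences : ℕ → ℕ
  #sequences zero    = 1
  #sequences (suc j) = #sequences j * ((k ∸ j) * m)

  sequence-size : ∀ j → HasSize (Sequence {j}) (#sequences j)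
  sequence-size zero = hasSize-cong (λ { [] refl → (λ ()) , λ () }) (λ { [] _ → refl }) (hasSize-singleton [])
  sequence-size (suc j) = hasSize-cong cons uncons
    (hasSize-Σ Cons (sequence-size j)
      (λ v (_ , distinct) → hasSize-image (_∷ v) (λ { _ _ refl → refl })
        (λ {x} p → x , p , refl) (λ (x , p , e) → x , p , e) (extension-size v distinct))
      (λ { v v′ w _ _ (_ , _ , refl) (_ , _ , refl) → refl }))
    where
    Cons : Vec ℕ j → Vec ℕ (suc j) → Set
    Cons v w = ∃ λ x → (x < m * k × Free v (x % k)) × x ∷ v ≡ w
    cons : ∀ w → (∃ λ v → Sequence v × Cons v w) → Sequence w
    cons _ (v , (v< , distinct) , x , (x< , free) , refl) =
      (λ { Fin.zero → x< ; (Fin.suc i) → v< i }) ,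
      (λ { Fin.zero    Fin.zero    e → refl
         ; Fin.zero    (Fin.suc i) e → ⊥-elim (free i e)
         ; (Fin.suc i) Fin.zero    e → ⊥-elim (free i (sym e))
         ; (Fin.suc i) (Fin.suc j) e → cong Fin.suc (distinct i j e) })
    uncons : ∀ w → Sequence w → ∃ λ v → Sequence v × Cons v w
    uncons (x ∷ v) (w< , distinct) =
      v , ((λ i → w< (Fin.suc i)) , λ i i′ e → Fin.suc-injective (distinct _ _ e)) ,
      x , (w< Fin.zero , λ i e → Fin.0≢1+n (distinct Fin.zero (Fin.suc i) e)) , refl

  -- The factor (k - j)! completes the falling factorial k (k - 1) ... (k - j + 1) to k! and so
  -- avoids a quotient.
  #sequences-! : ∀ j → j ≤ k → #sequences j * (k ∸ j) ! ≡ k ! * m ^ j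
  #sequences-! zero    _   = trans (*-identityˡ (k !)) (sym (*-identityʳ (k !)))
  #sequences-! (suc j) j<k = begin
    #sequences j * ((k ∸ j) * m) * (k ∸ suc j) !    ≡⟨ lem (#sequences j) (k ∸ j) m ((k ∸ suc j) !) ⟩
    #sequences j * ((k ∸ j) * (k ∸ suc j) !) * m    ≡⟨ cong (λ z → #sequences j * (z * (k ∸ suc j) !) * m) k∸j≡ ⟩
    #sequences j * (suc (k ∸ suc j) !) * m          ≡⟨ cong (λ z → #sequences j * z ! * m) k∸j≡ ⟨
    #sequences j * (k ∸ j) ! * m                    ≡⟨ cong (_* m) (#sequences-! j (<⇒≤ j<k)) ⟩
    k ! * m ^ j * m                                 ≡⟨ lem′ (k !) (m ^ j) m ⟩
    k ! * (m * m ^ j)                               ∎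
    where
    open ≡-Reasoning
    k∸j≡ : k ∸ j ≡ suc (k ∸ suc j)
    k∸j≡ = +-∸-assoc 1 j<k
    lem : ∀ a b c d → a * (b * c) * d ≡ a * (b * d) * c
    lem = solve 4 (λ a b c d → a :* (b :* c) :* d := a :* (b :* d) :* c) refl
    lem′ : ∀ a b c → a * b * c ≡ a * (c * b)
    lem′ = solve 3 (λ a b c → a :* b :* c := a :* (c :* b)) refl

  full-sequence-size : HasSize (Sequence {k}) (k ! * m ^ k)
  full-sequence-size = subst (HasSize Sequence) (begin
    #sequences k                ≡⟨ *-identityʳ _ ⟨
    #sequences k * 0 !          ≡⟨ cong (λ z → #sequences k * z !) (n∸n≡0 k) ⟨
    #sequences k * (k ∸ k) !    ≡⟨ #sequences-! k ≤-refl ⟩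
    k ! * m ^ k                 ∎) (sequence-size k)
    where open ≡-Reasoning

-- If the identity gives l a negative coefficient -x, then x (n - 1) replaces it modulo n.
bézout : ∀ n l .{{_ : NonZero n}} → ∃ λ e → Cong n (e * l) (gcd l n)
bézout n l with Bézout.identity (gcd-GCD l n)
... | Bézout.+- x y e = x , congruent {u = 0} {y} (trans (+-identityʳ _) (sym e))
... | Bézout.-+ x y e = x * (n ∸ 1) , cong-cancelʳ (x * l)
  (cong-trans (cong-reflexive (lem x l (n ∸ 1))) (cong-trans (cong-neg (x * l))
    (cong-sym (cong-trans (cong-reflexive e) (cong-multiple y)))))
  where
  lem : ∀ x l n → x * n * l + x * l ≡ x * l + x * l * n
  lem = solve 3 (λ x l n → x :* n :* l :+ x :* l := x :* l :+ x :* l :* n) refl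

-- Permutations and powers of the cycle

vec-ext : ∀ {A : Set} {k} {v w : Vec A k} → (∀ i → lookup v i ≡ lookup w i) → v ≡ w
vec-ext {v = v} {w} e = trans (sym (tabulate∘lookup v)) (trans (tabulate-cong e) (tabulate∘lookup w))

-- A missed value y, added as one more value, would inject n + 1 elements into n.
injective⇒surjective : ∀ {n} (f : Fin n → Fin n) → (∀ i j → f i ≡ f j → i ≡ j) → ∀ y → ∃ λ x → f x ≡ y
injective⇒surjective {n} f inj y with Fin.any? (λ x → f x Fin.≟ y)
... | yes p = p
... | no ¬p = ⊥-elim (1+n≰n (Fin.injective⇒≤ {f = g} (λ {i} {j} → g-injective i j)))
  where
  g : Fin (suc n) → Fin n
  g Fin.zero    = y
  g (Fin.suc i) = f i
  g-injective : ∀ i j → g i ≡ g j → i ≡ j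
  g-injective Fin.zero    Fin.zero    _ = refl
  g-injective Fin.zero    (Fin.suc j) e = ⊥-elim (¬p (j , sym e))
  g-injective (Fin.suc i) Fin.zero    e = ⊥-elim (¬p (i , e))
  g-injective (Fin.suc i) (Fin.suc j) e = cong Fin.suc (inj i j e)

module _ {n : ℕ} where

  app-· : (α β : Perm n) (i : Fin n) → app (α · β) i ≡ app β (app α i)
  app-· α β i = lookup-map i (lookup β) α

  ·-assoc : (α β γ : Perm n) → (α · β) · γ ≡ α · (β · γ)
  ·-assoc α β γ = vec-ext λ i → begin
    app ((α · β) · γ) i      ≡⟨ app-· (α · β) γ i ⟩
    app γ (app (α · β) i)    ≡⟨ cong (app γ) (app-· α β i) ⟩
    app γ (app β (app α i))  ≡⟨ app-· β γ (app α i) ⟨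
    app (β · γ) (app α i)    ≡⟨ app-· α (β · γ) i ⟨
    app (α · (β · γ)) i      ∎
    where open ≡-Reasoning

  ·-identityˡ : (α : Perm n) → idP n · α ≡ α
  ·-identityˡ α = map-lookup-allFin α

  ·-identityʳ : (α : Perm n) → α · idP n ≡ α
  ·-identityʳ α = vec-ext λ i → trans (app-· α (idP n) i) (lookup-allFin (app α i))

  isPerm-id : IsPerm (idP n)
  isPerm-id i j e = trans (sym (lookup-allFin i)) (trans e (lookup-allFin j))

  isPerm-· : (α β : Perm n) → IsPerm α → IsPerm β → IsPerm (α · β)
  isPerm-· α β pα pβ i j e = pα i j (pβ _ _ (trans (sym (app-· α β i)) (trans e (app-· α β j))))

  ·-cancelˡ : (α β γ : Perm n) → IsPerm α → α · β ≡ α · γ → β ≡ γ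
  ·-cancelˡ α β γ pα e = vec-ext λ y → let x , αx≡y = injective⇒surjective (app α) pα y in begin
    app β y          ≡⟨ cong (app β) αx≡y ⟨
    app β (app α x)  ≡⟨ app-· α β x ⟨
    app (α · β) x    ≡⟨ cong (λ δ → app δ x) e ⟩
    app (α · γ) x    ≡⟨ app-· α γ x ⟩
    app γ (app α x)  ≡⟨ cong (app γ) αx≡y ⟩
    app γ y          ∎
    where open ≡-Reasoning

  ·-cancelʳ : (α β γ : Perm n) → IsPerm γ → α · γ ≡ β · γ → α ≡ β
  ·-cancelʳ α β γ pγ e = vec-ext λ x →
    pγ _ _ (trans (sym (app-· α γ x)) (trans (cong (λ δ → app δ x) e) (app-· β γ x)))

module Cycle (n : ℕ) .{{_ : NonZero n}} (σ : Perm n) (σ-perm : IsPerm σ)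
             (a : ℕ → Fin n) (a-injective : ∀ i j → i < n → j < n → a i ≡ a j → i ≡ j)
             (σ-a : ∀ j → app σ (a j) ≡ a (suc j)) where

  private
    index : ∀ x → ∃ λ i → a (toℕ i) ≡ x
    index = injective⇒surjective (λ i → a (toℕ i))
      (λ i j e → Fin.toℕ-injective (a-injective _ _ (Fin.toℕ<n i) (Fin.toℕ<n j) e))

  pos : Fin n → ℕ
  pos x = toℕ (proj₁ (index x))

  pos<n : ∀ x → pos x < n
  pos<n x = Fin.toℕ<n (proj₁ (index x))

  a-pos : ∀ x → a (pos x) ≡ x
  a-pos x = proj₂ (index x)

  -- The orbit closes up because `σ` is injective: if a n were a (i + 1) with i + 1 < n, then `σ`
  -- would send a i and a (n - 1) to the same point, forcing i = n - 1.
  a-n : a n ≡ a 0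
  a-n with pos (a n) in e
  ... | zero  = trans (sym (a-pos (a n))) (cong a e)
  ... | suc i = ⊥-elim (<⇒≢ (subst (_< n) e (pos<n (a n))) (trans (cong suc i≡n-1) n≡))
    where
    n≡ : suc (n ∸ 1) ≡ n
    n≡ = suc-pred n
    i≡n-1 : i ≡ n ∸ 1
    i≡n-1 = a-injective i (n ∸ 1) (<-trans (n<1+n i) (subst (_< n) e (pos<n (a n)))) (≤-reflexive n≡)
      (σ-perm _ _ (begin
        app σ (a i)        ≡⟨ σ-a i ⟩
        a (suc i)          ≡⟨ cong a e ⟨
        a (pos (a n))      ≡⟨ a-pos (a n) ⟩
        a n                ≡⟨ cong a n≡ ⟨
        a (suc (n ∸ 1))    ≡⟨ σ-a (n ∸ 1) ⟨
        app σ (a (n ∸ 1))  ∎))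
      where open ≡-Reasoning

  a-+n : ∀ j → a (j + n) ≡ a j
  a-+n zero    = a-n
  a-+n (suc j) = trans (sym (σ-a (j + n))) (trans (cong (app σ) (a-+n j)) (σ-a j))

  a-+* : ∀ j u → a (j + u * n) ≡ a j
  a-+* j zero    = cong a (+-identityʳ j)
  a-+* j (suc u) = begin
    a (j + (n + u * n))  ≡⟨ cong (λ x → a (j + x)) (+-comm n (u * n)) ⟩
    a (j + (u * n + n))  ≡⟨ cong a (+-assoc j (u * n) n) ⟨
    a (j + u * n + n)    ≡⟨ a-+n (j + u * n) ⟩
    a (j + u * n)        ≡⟨ a-+* j u ⟩
    a j                  ∎
    where open ≡-Reasoning

  a-cong : ∀ {i j} → Cong n i j → a i ≡ a j
  a-cong {i} {j} (congruent {u} {v} e) = trans (sym (a-+* i u)) (trans (cong a e) (a-+* j v))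

  a-cong⁻ : ∀ {i j} → a i ≡ a j → Cong n i j
  a-cong⁻ {i} {j} e = cong-trans (cong-% i) (cong-trans (cong-reflexive
    (a-injective _ _ (m%n<n i n) (m%n<n j n)
      (trans (sym (a-cong (cong-% i))) (trans e (a-cong (cong-% j)))))) (cong-sym (cong-% j)))

  pos-a : ∀ i → Cong n (pos (a i)) i
  pos-a i = a-cong⁻ (a-pos (a i))

  isPerm-^ : ∀ k → IsPerm (σ ^ₚ k)
  isPerm-^ zero    = isPerm-id
  isPerm-^ (suc k) = isPerm-· σ (σ ^ₚ k) σ-perm (isPerm-^ k)

  app-^ : ∀ k j → app (σ ^ₚ k) (a j) ≡ a (k + j)
  app-^ zero    j = lookup-allFin (a j)
  app-^ (suc k) j = begin
    app (σ · σ ^ₚ k) (a j)      ≡⟨ app-· σ (σ ^ₚ k) (a j) ⟩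
    app (σ ^ₚ k) (app σ (a j))  ≡⟨ cong (app (σ ^ₚ k)) (σ-a j) ⟩
    app (σ ^ₚ k) (a (suc j))    ≡⟨ app-^ k (suc j) ⟩
    a (k + suc j)               ≡⟨ cong a (+-suc k j) ⟩
    a (suc k + j)               ∎
    where open ≡-Reasoning

  ext-a : {α β : Perm n} → (∀ j → app α (a j) ≡ app β (a j)) → α ≡ β
  ext-a {α} {β} e = vec-ext λ x →
    trans (cong (app α) (sym (a-pos x))) (trans (e (pos x)) (cong (app β) (a-pos x)))

  ^-+ : ∀ j k → σ ^ₚ (j + k) ≡ σ ^ₚ j · σ ^ₚ k
  ^-+ zero    k = sym (·-identityˡ _)
  ^-+ (suc j) k = trans (cong (σ ·_) (^-+ j k)) (sym (·-assoc σ (σ ^ₚ j) (σ ^ₚ k)))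

  ^-cong : ∀ {j k} → Cong n j k → σ ^ₚ j ≡ σ ^ₚ k
  ^-cong {j} {k} c = ext-a λ i →
    trans (app-^ j i) (trans (a-cong (cong-+ c cong-refl)) (sym (app-^ k i)))

  ^-cong⁻ : ∀ {j k} → σ ^ₚ j ≡ σ ^ₚ k → Cong n j k
  ^-cong⁻ {j} {k} e = cong-cancelʳ 0 (a-cong⁻
    (trans (sym (app-^ j 0)) (trans (cong (λ α → app α (a 0)) e) (app-^ k 0))))

  ^-comm : ∀ j k → σ ^ₚ j · σ ^ₚ k ≡ σ ^ₚ k · σ ^ₚ j
  ^-comm j k = trans (sym (^-+ j k)) (trans (cong (σ ^ₚ_) (+-comm j k)) (^-+ k j))

  neg : ℕ → ℕ
  neg k = k * (n ∸ 1)

  ^-inverseʳ : ∀ k → σ ^ₚ k · σ ^ₚ neg k ≡ idP n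
  ^-inverseʳ k = trans (sym (^-+ k (neg k))) (^-cong (cong-neg k))

  ^-inverseˡ : ∀ k → σ ^ₚ neg k · σ ^ₚ k ≡ idP n
  ^-inverseˡ k = trans (^-comm (neg k) k) (^-inverseʳ k)

  -- The subgroup of pairs (k , l) belonging to a permutation

  record Intertwines (ξ : Perm n) (k l : ℕ) : Set where
    constructor intertwines
    field equation : σ ^ₚ k · ξ ≡ ξ · σ ^ₚ l
  open Intertwines

  intertwines? : ∀ ξ k l → Dec (Intertwines ξ k l)
  intertwines? ξ k l = map′ intertwines equation (≡-dec Fin._≟_ _ _)

  intertwines-zero : ∀ ξ → Intertwines ξ 0 0
  intertwines-zero ξ = intertwines (trans (·-identityˡ ξ) (sym (·-identityʳ ξ)))

  intertwines-cong : ∀ {ξ k k′ l l′} → Cong n k k′ → Cong n l l′ → Intertwines ξ k l → Intertwines ξ k′ l′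
  intertwines-cong {ξ} ck cl (intertwines e) = intertwines (subst₂ (λ α β → α · ξ ≡ ξ · β) (^-cong ck) (^-cong cl) e)

  ^-+-· : ∀ {ξ k′ l′} k → Intertwines ξ k′ l′ → σ ^ₚ (k + k′) · ξ ≡ (σ ^ₚ k · ξ) · σ ^ₚ l′
  ^-+-· {ξ} {k′} {l′} k (intertwines e) = begin
    σ ^ₚ (k + k′) · ξ         ≡⟨ cong (_· ξ) (^-+ k k′) ⟩
    (σ ^ₚ k · σ ^ₚ k′) · ξ    ≡⟨ ·-assoc (σ ^ₚ k) (σ ^ₚ k′) ξ ⟩
    σ ^ₚ k · (σ ^ₚ k′ · ξ)    ≡⟨ cong (σ ^ₚ k ·_) e ⟩
    σ ^ₚ k · (ξ · σ ^ₚ l′)    ≡⟨ ·-assoc (σ ^ₚ k) ξ (σ ^ₚ l′) ⟨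
    (σ ^ₚ k · ξ) · σ ^ₚ l′    ∎
    where open ≡-Reasoning

  ·-^-+ : ∀ ξ l l′ → ξ · σ ^ₚ (l + l′) ≡ (ξ · σ ^ₚ l) · σ ^ₚ l′
  ·-^-+ ξ l l′ = trans (cong (ξ ·_) (^-+ l l′)) (sym (·-assoc ξ (σ ^ₚ l) (σ ^ₚ l′)))

  intertwines-+ : ∀ {ξ k l k′ l′} → Intertwines ξ k l → Intertwines ξ k′ l′ → Intertwines ξ (k + k′) (l + l′)
  intertwines-+ {ξ} {k} {l} {k′} {l′} r r′ = intertwines
    (trans (^-+-· k r′) (trans (cong (_· σ ^ₚ l′) (equation r)) (sym (·-^-+ ξ l l′))))

  -- Closure of the subgroup under differences, phrased without subtraction.
  intertwines-cancel : ∀ {ξ k l k′ l′} → Intertwines ξ (k + k′) (l + l′) → Intertwines ξ k′ l′ → Intertwines ξ k l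
  intertwines-cancel {ξ} {k} {l} {k′} {l′} r r′ = intertwines
    (·-cancelʳ (σ ^ₚ k · ξ) (ξ · σ ^ₚ l) (σ ^ₚ l′) (isPerm-^ l′)
      (trans (sym (^-+-· k r′)) (trans (equation r) (·-^-+ ξ l l′))))

  intertwines-* : ∀ {ξ k l} q → Intertwines ξ k l → Intertwines ξ (q * k) (q * l)
  intertwines-* {ξ} zero    r = intertwines-zero ξ
  intertwines-*     (suc q) r = intertwines-+ r (intertwines-* q r)

  intertwines-functional : ∀ {ξ k l l′} → IsPerm ξ → Intertwines ξ k l → Intertwines ξ k l′ → Cong n l l′
  intertwines-functional {ξ} {_} {l} {l′} pξ (intertwines e) (intertwines e′) =
    ^-cong⁻ (·-cancelˡ ξ (σ ^ₚ l) (σ ^ₚ l′) pξ (trans (sym e) e′))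

  intertwines-injective : ∀ {ξ k k′ l} → IsPerm ξ → Intertwines ξ k l → Intertwines ξ k′ l → Cong n k k′
  intertwines-injective {ξ} {k} {k′} pξ (intertwines e) (intertwines e′) =
    ^-cong⁻ (·-cancelʳ (σ ^ₚ k) (σ ^ₚ k′) ξ pξ (trans e (sym e′)))

  -- The first clause of f without the bound k < n; in this form it also covers ⟨ n , n ⟩.
  Minimal : Perm n → ℕ → ℕ → Set
  Minimal ξ r t = Intertwines ξ r t × (∀ k l → 1 ≤ k → k < r → ¬ Intertwines ξ k l)

  -- Subtract q = k / r times (r , t). The remainder k % r is paired with l - q t, so minimality
  -- makes it 0; and a first entry 0 forces l - q t ≡ 0.
  minimal-∣ : ∀ {ξ r t k l} → IsPerm ξ → 1 ≤ r → Minimal ξ r t → Intertwines ξ k l →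
              ∃ λ q → k ≡ q * r × Cong n l (q * t)
  minimal-∣ {ξ} {r@(suc _)} {t} {k} {l} pξ _ (Irt , least) Ikl =
    q , trans k≡ (cong (_+ q * r) k%r≡0) ,
    cong-trans (cong-sym l′+qt≈l) (cong-+ (intertwines-functional pξ (subst (λ x → Intertwines ξ x l′) k%r≡0 Ik%r) (intertwines-zero ξ)) cong-refl)
    where
    q = k / r
    -- l − q t
    l′ = l + neg (q * t)
    k≡ : k ≡ k % r + q * r
    k≡ = m≡m%n+[m/n]*n k r
    l′+qt≈l : Cong n (l′ + q * t) l
    l′+qt≈l = cong-trans (cong-reflexive (trans (+-assoc l _ _) (cong (l +_) (+-comm _ (q * t)))))
      (cong-trans (cong-+ cong-refl (cong-neg (q * t))) (cong-reflexive (+-identityʳ l)))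
    Ik%r : Intertwines ξ (k % r) l′
    Ik%r = intertwines-cancel (intertwines-cong (cong-reflexive k≡) (cong-sym l′+qt≈l) Ikl) (intertwines-* q Irt)
    k%r≡0 : k % r ≡ 0
    k%r≡0 = n<1⇒n≡0 (≰⇒> λ 1≤k%r → least (k % r) l′ 1≤k%r (m%n<n k r) Ik%r)

  -- Let d = gcd (t , n). The pair (n , 0) is a multiple q (r , t), so n = q r divides q t, and r
  -- divides both t and n. Conversely (n / d) (r , t) has second entry 0 modulo n, hence also first
  -- entry 0, and n ∣ (n / d) r gives d ∣ r.
  minimal⇒vertex : ∀ {ξ r t} → IsPerm ξ → 1 ≤ r → Minimal ξ r t → 1 ≤ t → t ≤ n → IsVertex n r t
  minimal⇒vertex {ξ} {r} {t} pξ 1≤r min@(Irt , _) lo hi = lo , hi , ∣-antisym d∣r r∣d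
    where
    r∣d : r ∣ gcd t n
    r∣d with q , n≡qr , c ← minimal-∣ pξ 1≤r min (intertwines-cong (cong-sym cong-self) cong-refl (intertwines-zero ξ)) =
      gcd-greatest (*-cancelˡ-∣ q {{q≢0}} (subst (_∣ q * t) n≡qr (cong⇒∣ (cong-sym c)))) (divides q n≡qr)
      where
      q≢0 : NonZero q
      q≢0 = ≢-nonZero λ { refl → >⇒≢ (>-nonZero⁻¹ n) n≡qr }
    d∣r : gcd t n ∣ r
    d∣r with divides m n≡md ← gcd[m,n]∣n t n | divides t′ t≡t′d ← gcd[m,n]∣m t n =
      *-cancelˡ-∣ m {{m≢0}} (subst (_∣ m * r) n≡md (cong⇒∣ (intertwines-injective pξ
        (intertwines-cong cong-refl mt≈0 (intertwines-* m Irt)) (intertwines-zero ξ))))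
      where
      m≢0 : NonZero m
      m≢0 = ≢-nonZero λ { refl → >⇒≢ (>-nonZero⁻¹ n) n≡md }
      mt≈0 : Cong n (m * t) 0
      mt≈0 = ∣⇒cong (divides t′ (begin
        m * t                ≡⟨ cong (m *_) t≡t′d ⟩
        m * (t′ * gcd t n)   ≡⟨ *-assoc m t′ (gcd t n) ⟨
        m * t′ * gcd t n     ≡⟨ cong (_* gcd t n) (*-comm m t′) ⟩
        t′ * m * gcd t n     ≡⟨ *-assoc t′ m (gcd t n) ⟩
        t′ * (m * gcd t n)   ≡⟨ cong (t′ *_) n≡md ⟨
        t′ * n               ∎))
        where open ≡-Reasoning

  intertwines-shift? : ∀ ξ k → Dec (∃ λ l → Intertwines ξ k l)
  intertwines-shift? ξ k = map′ (λ (l , _ , r) → l , r)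
    (λ (l , r) → l % n , m%n<n l n , intertwines-cong cong-refl (cong-% l) r)
    (anyUpTo? (intertwines? ξ k) n)

  minimal? : ∀ r t ξ → Dec (Minimal ξ r t)
  minimal? r t ξ = intertwines? ξ r t ×-dec map′ to-all from-all (allUpTo? (λ k → least? k) r)
    where
    least? : ∀ k → Dec (1 ≤ k → ¬ ∃ λ l → Intertwines ξ k l)
    least? k = (1 ≤? k) →-dec ¬? (intertwines-shift? ξ k)
    to-all : (∀ {k} → k < r → 1 ≤ k → ¬ ∃ λ l → Intertwines ξ k l) → ∀ k l → 1 ≤ k → k < r → ¬ Intertwines ξ k l
    to-all f k l 1≤k k<r Ikl = f k<r 1≤k (l , Ikl)
    from-all : (∀ k l → 1 ≤ k → k < r → ¬ Intertwines ξ k l) → ∀ {k} → k < r → 1 ≤ k → ¬ ∃ λ l → Intertwines ξ k l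
    from-all f k<r 1≤k (l , Ikl) = f _ l 1≤k k<r Ikl

  -- The descent starts from (n , 0), available for every ξ because σ^n is the identity. At the
  -- bottom the second entry is moved into 1, ..., n.
  minimal-exists : ∀ ξ → ∃ λ r → ∃ λ t → 1 ≤ r × 1 ≤ t × t ≤ n × Minimal ξ r t
  minimal-exists ξ = <-rec (λ k → 1 ≤ k → (∃ λ l → Intertwines ξ k l) → Goal) descend n (>-nonZero⁻¹ n)
    (0 , intertwines-cong (cong-sym cong-self) cong-refl (intertwines-zero ξ))
    where
    Goal : Set
    Goal = ∃ λ r → ∃ λ t → 1 ≤ r × 1 ≤ t × t ≤ n × Minimal ξ r t
    descend : ∀ k → (∀ {k′} → k′ < k → 1 ≤ k′ → (∃ λ l → Intertwines ξ k′ l) → Goal) →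
              1 ≤ k → (∃ λ l → Intertwines ξ k l) → Goal
    descend k rec 1≤k (l , Ikl) with anyUpTo? (λ k′ → (1 ≤? k′) ×-dec intertwines-shift? ξ k′) k
    ... | yes (k′ , k′<k , 1≤k′ , I′) = rec k′<k 1≤k′ I′
    ... | no none with t , lo , hi , t≈l ← range l =
      k , t , 1≤k , lo , hi , intertwines-cong cong-refl (cong-sym t≈l) Ikl ,
      λ k′ l′ 1≤k′ k′<k I′ → none (k′ , k′<k , 1≤k′ , l′ , I′)

  minimal-unique : ∀ {ξ r t r′ t′} → IsPerm ξ → Minimal ξ r t → Minimal ξ r′ t′ →
    1 ≤ r → 1 ≤ t → t ≤ n → 1 ≤ r′ → 1 ≤ t′ → t′ ≤ n → (r , t) ≡ (r′ , t′)
  minimal-unique {ξ} {r} {t} {r′} {t′} pξ (I₁ , least) (I₂ , least′) lr lo hi lr′ lo′ hi′ =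
    cong₂ _,_ r≡r′ (cong-range⇒≡ lo hi lo′ hi′
      (intertwines-functional pξ (intertwines-cong (cong-reflexive r≡r′) (cong-refl {x = t}) I₁) I₂))
    where
    r≡r′ : r ≡ r′
    r≡r′ = ≤-antisym (≮⇒≥ λ r′<r → least r′ t′ lr′ r′<r I₂) (≮⇒≥ λ r<r′ → least′ r t lr r<r′ I₁)

  -- σ-equivalence and the size of a class

  infix 4 _~_
  _~_ : Perm n → Perm n → Set
  _~_ = SigmaEquiv σ

  ~-refl : ∀ ξ → ξ ~ ξ
  ~-refl ξ = 0 , 0 , equation (intertwines-zero ξ)

  ·-^-cancel : ∀ ξ b → (ξ · σ ^ₚ b) · σ ^ₚ neg b ≡ ξ
  ·-^-cancel ξ b = trans (·-assoc ξ (σ ^ₚ b) (σ ^ₚ neg b)) (trans (cong (ξ ·_) (^-inverseʳ b)) (·-identityʳ ξ))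

  ~-solve : ∀ {α β} a b → σ ^ₚ a · α ≡ β · σ ^ₚ b → (σ ^ₚ a · α) · σ ^ₚ neg b ≡ β
  ~-solve {β = β} a b e = trans (cong (_· σ ^ₚ neg b) e) (·-^-cancel β b)

  ~-sym : ∀ {α β} → α ~ β → β ~ α
  ~-sym {α} {β} (a , b , e) = neg a , neg b , (begin
    σ ^ₚ neg a · β                               ≡⟨ cong (σ ^ₚ neg a ·_) (~-solve {α} {β} a b e) ⟨
    σ ^ₚ neg a · ((σ ^ₚ a · α) · σ ^ₚ neg b)     ≡⟨ ·-assoc (σ ^ₚ neg a) (σ ^ₚ a · α) (σ ^ₚ neg b) ⟨
    (σ ^ₚ neg a · (σ ^ₚ a · α)) · σ ^ₚ neg b     ≡⟨ cong (_· σ ^ₚ neg b) (begin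
      σ ^ₚ neg a · (σ ^ₚ a · α)  ≡⟨ ·-assoc (σ ^ₚ neg a) (σ ^ₚ a) α ⟨
      (σ ^ₚ neg a · σ ^ₚ a) · α  ≡⟨ cong (_· α) (^-inverseˡ a) ⟩
      idP n · α                  ≡⟨ ·-identityˡ α ⟩
      α                          ∎) ⟩
    α · σ ^ₚ neg b                               ∎)
    where open ≡-Reasoning

  ~-trans : ∀ {α β γ} → α ~ β → β ~ γ → α ~ γ
  ~-trans {α} {β} {γ} (a , b , e) (c , d , f) = c + a , d + b , (begin
    σ ^ₚ (c + a) · α           ≡⟨ cong (_· α) (^-+ c a) ⟩
    (σ ^ₚ c · σ ^ₚ a) · α      ≡⟨ ·-assoc (σ ^ₚ c) (σ ^ₚ a) α ⟩
    σ ^ₚ c · (σ ^ₚ a · α)      ≡⟨ cong (σ ^ₚ c ·_) e ⟩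
    σ ^ₚ c · (β · σ ^ₚ b)      ≡⟨ ·-assoc (σ ^ₚ c) β (σ ^ₚ b) ⟨
    (σ ^ₚ c · β) · σ ^ₚ b      ≡⟨ cong (_· σ ^ₚ b) f ⟩
    (γ · σ ^ₚ d) · σ ^ₚ b      ≡⟨ ·-^-+ γ d b ⟨
    γ · σ ^ₚ (d + b)           ∎)
    where open ≡-Reasoning

  -- Exponents matter only modulo n, so finitely many pairs have to be tried.
  ~? : ∀ α β → Dec (α ~ β)
  ~? α β = map′ (λ (a , _ , b , _ , e) → a , b , e)
    (λ (a , b , e) → a % n , m%n<n a n , b % n , m%n<n b n ,
      subst₂ (λ γ δ → γ · α ≡ β · δ) (^-cong (cong-% a)) (^-cong (cong-% b)) e)
    (anyUpTo? (λ a → anyUpTo? (λ b → ≡-dec Fin._≟_ (σ ^ₚ a · α) (β · σ ^ₚ b)) n) n)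

  -- Powers of `σ` commute, so the factors σ^a and σ^b can be carried past σ^k and σ^l.
  intertwines-resp-~ : ∀ {α β k l} → α ~ β → Intertwines α k l → Intertwines β k l
  intertwines-resp-~ {α} {β} {k} {l} (a , b , e) (intertwines r) = intertwines (·-cancelʳ (σ ^ₚ k · β) (β · σ ^ₚ l) (σ ^ₚ b) (isPerm-^ b) (begin
    (σ ^ₚ k · β) · σ ^ₚ b      ≡⟨ ·-assoc (σ ^ₚ k) β (σ ^ₚ b) ⟩
    σ ^ₚ k · (β · σ ^ₚ b)      ≡⟨ cong (σ ^ₚ k ·_) e ⟨
    σ ^ₚ k · (σ ^ₚ a · α)      ≡⟨ ·-assoc (σ ^ₚ k) (σ ^ₚ a) α ⟨
    (σ ^ₚ k · σ ^ₚ a) · α      ≡⟨ cong (_· α) (^-comm k a) ⟩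
    (σ ^ₚ a · σ ^ₚ k) · α      ≡⟨ ·-assoc (σ ^ₚ a) (σ ^ₚ k) α ⟩
    σ ^ₚ a · (σ ^ₚ k · α)      ≡⟨ cong (σ ^ₚ a ·_) r ⟩
    σ ^ₚ a · (α · σ ^ₚ l)      ≡⟨ ·-assoc (σ ^ₚ a) α (σ ^ₚ l) ⟨
    (σ ^ₚ a · α) · σ ^ₚ l      ≡⟨ cong (_· σ ^ₚ l) e ⟩
    (β · σ ^ₚ b) · σ ^ₚ l      ≡⟨ ·-assoc β (σ ^ₚ b) (σ ^ₚ l) ⟩
    β · (σ ^ₚ b · σ ^ₚ l)      ≡⟨ cong (β ·_) (^-comm b l) ⟩
    β · (σ ^ₚ l · σ ^ₚ b)      ≡⟨ ·-assoc β (σ ^ₚ l) (σ ^ₚ b) ⟨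
    (β · σ ^ₚ l) · σ ^ₚ b      ∎))
    where open ≡-Reasoning

  minimal-resp-~ : ∀ {α β r t} → α ~ β → Minimal α r t → Minimal β r t
  minimal-resp-~ {α} {β} α~β (r , least) =
    intertwines-resp-~ {α} {β} α~β r ,
    λ k l 1≤k k<r r′ → least k l 1≤k k<r (intertwines-resp-~ {β} {α} (~-sym {α} {β} α~β) r′)

  Class : Perm n → Perm n → Set
  Class ξ β = IsPerm β × ξ ~ β

  -- With r minimal the products σ^a ξ σ^b, a < r, b < n, are distinct and exhaust the class of ξ.
  class-size : ∀ {ξ r t} → IsPerm ξ → 1 ≤ r → Minimal ξ r t → HasSize (Class ξ) (r * n)
  class-size {ξ} {r@(suc _)} {t} pξ _ (Irt , least) =
    hasSize-cong ⇒class class⇒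
      (hasSize-Σ Row (hasSize-< r) (λ i _ → row-size i) row-disjoint)
    where
    elt : ℕ → ℕ → Perm n
    elt i j = (σ ^ₚ i · ξ) · σ ^ₚ j
    isPerm-base : ∀ i → IsPerm (σ ^ₚ i · ξ)
    isPerm-base i = isPerm-· (σ ^ₚ i) ξ (isPerm-^ i) pξ
    Row : ℕ → Perm n → Set
    Row i β = ∃ λ j → j < n × elt i j ≡ β
    row-size : ∀ i → HasSize (Row i) n
    row-size i = hasSize-image (elt i)
      (λ {j} {j′} j<n j′<n e → cong-<⇒≡ j<n j′<n (^-cong⁻ (·-cancelˡ (σ ^ₚ i · ξ) (σ ^ₚ j) (σ ^ₚ j′) (isPerm-base i) e)))
      (λ {j} j<n → j , j<n , refl) (λ (j , j<n , e) → j , j<n , e) (hasSize-< n)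
    -- A permutation common to rows i < i′ would give σ^(i′ - i) ξ = ξ σ^(j - j′) with 0 < i′ - i <
    -- r, against minimality.
    row-< : ∀ {i i′ β} → i < r → i′ < r → Row i β → Row i′ β → ¬ i < i′
    row-< {i} {i′} {β} i<r i′<r (j , _ , e) (j′ , _ , e′) i<i′ =
      least d (j + neg j′) (m<n⇒0<n∸m i<i′) (≤-<-trans (m∸n≤m i′ i) i′<r) (intertwines (begin
        σ ^ₚ d · ξ                               ≡⟨ ·-^-cancel (σ ^ₚ d · ξ) j′ ⟨
        ((σ ^ₚ d · ξ) · σ ^ₚ j′) · σ ^ₚ neg j′   ≡⟨ cong (_· σ ^ₚ neg j′) shifted ⟨
        (ξ · σ ^ₚ j) · σ ^ₚ neg j′               ≡⟨ ·-^-+ ξ j (neg j′) ⟨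
        ξ · σ ^ₚ (j + neg j′)                    ∎))
      where
      open ≡-Reasoning
      d = i′ ∸ i
      shifted : ξ · σ ^ₚ j ≡ (σ ^ₚ d · ξ) · σ ^ₚ j′
      shifted = ·-cancelˡ (σ ^ₚ i) (ξ · σ ^ₚ j) ((σ ^ₚ d · ξ) · σ ^ₚ j′) (isPerm-^ i) (begin
        σ ^ₚ i · (ξ · σ ^ₚ j)                ≡⟨ ·-assoc (σ ^ₚ i) ξ (σ ^ₚ j) ⟨
        elt i j                              ≡⟨ trans e (sym e′) ⟩
        (σ ^ₚ i′ · ξ) · σ ^ₚ j′              ≡⟨ cong (λ z → (σ ^ₚ z · ξ) · σ ^ₚ j′) (m+[n∸m]≡n (<⇒≤ i<i′)) ⟨
        (σ ^ₚ (i + d) · ξ) · σ ^ₚ j′         ≡⟨ cong (λ z → (z · ξ) · σ ^ₚ j′) (^-+ i d) ⟩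
        ((σ ^ₚ i · σ ^ₚ d) · ξ) · σ ^ₚ j′    ≡⟨ cong (_· σ ^ₚ j′) (·-assoc (σ ^ₚ i) (σ ^ₚ d) ξ) ⟩
        (σ ^ₚ i · (σ ^ₚ d · ξ)) · σ ^ₚ j′    ≡⟨ ·-assoc (σ ^ₚ i) (σ ^ₚ d · ξ) (σ ^ₚ j′) ⟩
        σ ^ₚ i · ((σ ^ₚ d · ξ) · σ ^ₚ j′)    ∎)
    row-disjoint : ∀ i i′ β → i < r → i′ < r → Row i β → Row i′ β → i ≡ i′
    row-disjoint i i′ β i<r i′<r p p′ =
      ≤-antisym (≮⇒≥ (row-< i′<r i<r p′ p)) (≮⇒≥ (row-< i<r i′<r p p′))
    elt-~ : ∀ i j → ξ ~ elt i j
    elt-~ i j = i , neg j , sym (·-^-cancel (σ ^ₚ i · ξ) j)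
    ⇒class : ∀ β → (∃ λ i → i < r × Row i β) → Class ξ β
    ⇒class β (i , _ , j , _ , refl) =
      isPerm-· (σ ^ₚ i · ξ) (σ ^ₚ j) (isPerm-base i) (isPerm-^ j) , elt-~ i j
    class⇒ : ∀ β → Class ξ β → ∃ λ i → i < r × Row i β
    -- Here β = σ^x ξ σ^(-y). Splitting x into x % r and a multiple of r, each r moved across ξ
    -- becomes a t on the right.
    class⇒ β (_ , x , y , e) = x % r , m%n<n x r , j % n , m%n<n j n , (begin
      elt (x % r) (j % n)                          ≡⟨ cong ((σ ^ₚ (x % r) · ξ) ·_) (^-cong (cong-% j)) ⟨
      elt (x % r) j                                ≡⟨ ·-^-+ (σ ^ₚ (x % r) · ξ) (x / r * t) (neg y) ⟩
      elt (x % r) (x / r * t) · σ ^ₚ neg y         ≡⟨ cong (_· σ ^ₚ neg y) (^-+-· (x % r) (intertwines-* (x / r) Irt)) ⟨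
      (σ ^ₚ (x % r + x / r * r) · ξ) · σ ^ₚ neg y  ≡⟨ cong (λ z → (σ ^ₚ z · ξ) · σ ^ₚ neg y) (m≡m%n+[m/n]*n x r) ⟨
      (σ ^ₚ x · ξ) · σ ^ₚ neg y                    ≡⟨ ~-solve {ξ} {β} x y e ⟩
      β                                            ∎)
      where
      open ≡-Reasoning
      j = x / r * t + neg y

  -- The number of permutations in [ k , l ], counted in coordinates along the cycle

  -- ξ after identifying Fin n with ℤ/n along j ↦ a j.
  coord : Perm n → ℕ → ℕ
  coord ξ i = pos (app ξ (a i))

  a-coord : ∀ ξ i → a (coord ξ i) ≡ app ξ (a i)
  a-coord ξ i = a-pos (app ξ (a i))

  app-^-· : ∀ ξ k i → app (σ ^ₚ k · ξ) (a i) ≡ app ξ (a (k + i))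
  app-^-· ξ k i = trans (app-· (σ ^ₚ k) ξ (a i)) (cong (app ξ) (app-^ k i))

  app-·-^ : ∀ ξ l i → app (ξ · σ ^ₚ l) (a i) ≡ a (l + coord ξ i)
  app-·-^ ξ l i = trans (app-· ξ (σ ^ₚ l) (a i))
    (trans (cong (app (σ ^ₚ l)) (sym (a-coord ξ i))) (app-^ l (coord ξ i)))

  coord-shift : ∀ {ξ k l} → Intertwines ξ k l → ∀ i → Cong n (coord ξ (k + i)) (l + coord ξ i)
  coord-shift {ξ} {k} {l} (intertwines e) i = a-cong⁻ (begin
    a (coord ξ (k + i))         ≡⟨ a-coord ξ (k + i) ⟩
    app ξ (a (k + i))           ≡⟨ app-^-· ξ k i ⟨
    app (σ ^ₚ k · ξ) (a i)      ≡⟨ cong (λ α → app α (a i)) e ⟩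
    app (ξ · σ ^ₚ l) (a i)      ≡⟨ app-·-^ ξ l i ⟩
    a (l + coord ξ i)           ∎)
    where open ≡-Reasoning

  coord-injective : ∀ {ξ i j} → IsPerm ξ → Cong n (coord ξ i) (coord ξ j) → Cong n i j
  coord-injective {ξ} {i} {j} pξ c = a-cong⁻ (pξ (a i) (a j)
    (trans (sym (a-coord ξ i)) (trans (a-cong c) (a-coord ξ j))))

  -- The multiplier e stands in for an inverse of l / k modulo m.
  module Fixed (k l m : ℕ) .{{k≢0 : NonZero k}} (n≡mk : n ≡ m * k) (k∣l : k ∣ l)
               (e : ℕ) (el≈k : Cong n (e * l) k) where
    open Residues k m

    k∣n : k ∣ n
    k∣n = divides m n≡mk

    -- The permutation with σ^k ξ = ξ σ^l and ξ (a i) = a (vᵢ) for i < k.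
    value : Vec ℕ k → ℕ → ℕ
    value v i = lookup v (i mod k) + i / k * l

    mod-cong : ∀ {i j} → i % k ≡ j % k → i mod k ≡ j mod k
    mod-cong {i} {j} eq = Fin.toℕ-injective
      (trans (Fin.toℕ-fromℕ< _) (trans eq (sym (Fin.toℕ-fromℕ< _))))

    value-shift : ∀ v i → value v (i + k) ≡ l + value v i
    value-shift v i = begin
      lookup v ((i + k) mod k) + (i + k) / k * l  ≡⟨ cong₂ (λ x y → lookup v x + y * l) (mod-cong ([m+n]%n≡m%n i k)) quot ⟩
      lookup v (i mod k) + (1 + i / k) * l        ≡⟨ lem (lookup v (i mod k)) (i / k) l ⟩
      l + value v i                               ∎
      where
      open ≡-Reasoning
      quot : (i + k) / k ≡ 1 + i / k
      quot = trans (m/n≡1+[m∸n]/n (m≤n+m k i)) (cong (λ z → 1 + z / k) (m+n∸n≡m i k))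
      lem : ∀ x y l → x + (1 + y) * l ≡ l + (x + y * l)
      lem = solve 3 (λ x y l → x :+ (con 1 :+ y) :* l := l :+ (x :+ y :* l)) refl

    value-shifts : ∀ v i u → value v (i + u * k) ≡ u * l + value v i
    value-shifts v i zero    = cong (value v) (+-identityʳ i)
    value-shifts v i (suc u) = begin
      value v (i + (k + u * k))   ≡⟨ cong (value v) (trans (cong (i +_) (+-comm k (u * k))) (sym (+-assoc i (u * k) k))) ⟩
      value v (i + u * k + k)     ≡⟨ value-shift v (i + u * k) ⟩
      l + value v (i + u * k)     ≡⟨ cong (l +_) (value-shifts v i u) ⟩
      l + (u * l + value v i)     ≡⟨ +-assoc l (u * l) _ ⟨
      (l + u * l) + value v i     ∎
      where open ≡-Reasoning

    ml≈0 : Cong n (m * l) 0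
    ml≈0 = subst (λ z → Cong z (m * l) 0) (sym n≡mk) (∣⇒cong (*-monoʳ-∣ m k∣l))

    -- Adding n = m k to the argument adds m l to the value, a multiple of m k because k ∣ l.
    value-periodic : ∀ v i u → Cong n (value v (i + u * n)) (value v i)
    value-periodic v i u = cong-trans
      (cong-reflexive (trans (cong (λ z → value v (i + z)) (trans (cong (u *_) n≡mk) (sym (*-assoc u m k))))
                             (value-shifts v i (u * m))))
      (cong-+ (cong-trans (cong-reflexive (trans (*-assoc u m l) (*-comm u (m * l)))) (cong-*ʳ u ml≈0)) cong-refl)

    value-cong : ∀ v {i j} → Cong n i j → Cong n (value v i) (value v j)
    value-cong v {i} {j} (congruent {x} {y} eq) = cong-trans (cong-sym (value-periodic v i x))
      (cong-trans (cong-reflexive (cong (value v) eq)) (value-periodic v j y))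

    extend : Vec ℕ k → Perm n
    extend v = tabulate λ x → a (value v (pos x))

    app-extend : ∀ v i → app (extend v) (a i) ≡ a (value v i)
    app-extend v i = trans (lookup∘tabulate (λ x → a (value v (pos x))) (a i)) (a-cong (value-cong v (pos-a i)))

    coord-extend : ∀ v i → Cong n (coord (extend v) i) (value v i)
    coord-extend v i = a-cong⁻ (trans (a-coord (extend v) i) (app-extend v i))

    value-% : ∀ v i → Cong k (value v i) (lookup v (i mod k))
    value-% v i = cong-trans (cong-+ cong-refl (∣⇒cong (∣n⇒∣m*n (i / k) k∣l)))
                             (cong-reflexive (+-identityʳ _))

    -- Modulo k the value at i is `lookup v (i mod k)`, so equal values force equal remainders. Then
    -- the quotients times l agree modulo n, and multiplying by e turns l into k, which recovers i ≡
    -- j.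
    extend-perm : ∀ v → Sequence v → IsPerm (extend v)
    extend-perm v (_ , distinct) x y eq =
      trans (sym (a-pos x)) (trans (a-cong same) (a-pos y))
      where
      i = pos x
      j = pos y
      values : Cong n (value v i) (value v j)
      values = a-cong⁻ (trans (sym (app-extend v i)) (trans
        (subst₂ (λ z w → app (extend v) z ≡ app (extend v) w) (sym (a-pos x)) (sym (a-pos y)) eq) (app-extend v j)))
      residues : i mod k ≡ j mod k
      residues = distinct _ _ (cong⇒% (cong-trans (cong-sym (value-% v i))
        (cong-trans (cong-weaken k∣n values) (value-% v j))))
      i%k≡j%k : i % k ≡ j % k
      i%k≡j%k = trans (sym (Fin.toℕ-fromℕ< _)) (trans (cong toℕ residues) (Fin.toℕ-fromℕ< _))
      quotients : Cong n (i / k * l) (j / k * l)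
      quotients = cong-cancelʳ (lookup v (i mod k)) (cong-trans (cong-reflexive (+-comm _ (lookup v (i mod k))))
        (cong-trans values (cong-reflexive (trans (+-comm (lookup v (j mod k)) _)
          (cong (λ z → j / k * l + lookup v z) (sym residues))))))
      *l⇒*k : ∀ q → Cong n (q * l * e) (q * k)
      *l⇒*k q = cong-trans (cong-reflexive (lem q l e)) (cong-trans (cong-*ʳ q el≈k) (cong-reflexive (*-comm k q)))
        where
        lem : ∀ q l e → q * l * e ≡ e * l * q
        lem = solve 3 (λ q l e → q :* l :* e := e :* l :* q) refl
      same : Cong n i j
      same = cong-trans (cong-reflexive (m≡m%n+[m/n]*n i k)) (cong-trans
        (cong-+ (cong-reflexive i%k≡j%k) (cong-trans (cong-sym (*l⇒*k (i / k))) (cong-trans (cong-*ʳ e quotients) (*l⇒*k (j / k)))))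
        (cong-reflexive (sym (m≡m%n+[m/n]*n j k))))

    extend-intertwines : ∀ v → Intertwines (extend v) k l
    extend-intertwines v = intertwines (ext-a λ i → begin
      app (σ ^ₚ k · extend v) (a i)    ≡⟨ app-^-· (extend v) k i ⟩
      app (extend v) (a (k + i))       ≡⟨ app-extend v (k + i) ⟩
      a (value v (k + i))              ≡⟨ cong (λ z → a (value v z)) (+-comm k i) ⟩
      a (value v (i + k))              ≡⟨ cong a (value-shift v i) ⟩
      a (l + value v i)                ≡⟨ a-cong (cong-+ (cong-refl {x = l}) (cong-sym (coord-extend v i))) ⟩
      a (l + coord (extend v) i)       ≡⟨ app-·-^ (extend v) l i ⟨
      app (extend v · σ ^ₚ l) (a i)    ∎)
      where open ≡-Reasoning

    toℕ-mod : ∀ (i : Fin k) → toℕ i mod k ≡ i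
    toℕ-mod i = Fin.toℕ-injective (trans (Fin.toℕ-fromℕ< _) (m<n⇒m%n≡m (Fin.toℕ<n i)))

    value-toℕ : ∀ v i → value v (toℕ i) ≡ lookup v i
    value-toℕ v i = trans (cong₂ (λ x y → lookup v x + y * l) (toℕ-mod i) (m<n⇒m/n≡0 (Fin.toℕ<n i))) (+-identityʳ _)

    extend-injective : ∀ {v w} → Sequence v → Sequence w → extend v ≡ extend w → v ≡ w
    extend-injective {v} {w} (v< , _) (w< , _) eq = vec-ext λ i →
      cong-<⇒≡ (subst (lookup v i <_) (sym n≡mk) (v< i)) (subst (lookup w i <_) (sym n≡mk) (w< i))
        (cong-trans (cong-reflexive (sym (value-toℕ v i))) (cong-trans (a-cong⁻ (begin
          a (value v (toℕ i))             ≡⟨ app-extend v (toℕ i) ⟨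
          app (extend v) (a (toℕ i))      ≡⟨ cong (λ α → app α (a (toℕ i))) eq ⟩
          app (extend w) (a (toℕ i))      ≡⟨ app-extend w (toℕ i) ⟩
          a (value w (toℕ i))             ∎)) (cong-reflexive (value-toℕ w i))))
      where open ≡-Reasoning

    restrict : Perm n → Vec ℕ k
    restrict ξ = tabulate (λ i → coord ξ (toℕ i))

    lookup-restrict : ∀ ξ i → lookup (restrict ξ) i ≡ coord ξ (toℕ i)
    lookup-restrict ξ = lookup∘tabulate (λ i → coord ξ (toℕ i))

    coord-shifts : ∀ {ξ} → Intertwines ξ k l → ∀ q i → Cong n (coord ξ (q * k + i)) (q * l + coord ξ i)
    coord-shifts Ikl q i = coord-shift (intertwines-* q Ikl) i

    -- Coordinates of i and j that agree modulo k become equal after adding multiples x k and y k.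
    -- As e l ≡ k, this amounts to adding x e k and y e k to the arguments. Injectivity of ξ makes
    -- the new arguments congruent modulo n, so i ≡ j modulo k.
    restrict-sequence : ∀ ξ → IsPerm ξ → Intertwines ξ k l → Sequence (restrict ξ)
    restrict-sequence ξ pξ Ikl =
      (λ i → subst₂ _<_ (sym (lookup-restrict ξ i)) n≡mk (pos<n _)) ,
      λ i j eq → distinct i j (%⇒cong (trans (cong (_% k) (sym (lookup-restrict ξ i))) (trans eq (cong (_% k) (lookup-restrict ξ j)))))
      where
      shift-k : ∀ u i → Cong n (coord ξ (u * e * k + i)) (coord ξ i + u * k)
      shift-k u i = cong-trans (coord-shifts Ikl (u * e) i) (cong-trans
        (cong-+ (cong-trans (cong-reflexive (trans (*-assoc u e l) (*-comm u (e * l)))) (cong-*ʳ u el≈k)) cong-refl)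
        (cong-reflexive (trans (+-comm (k * u) _) (cong (coord ξ i +_) (*-comm k u)))))
      mod-k : ∀ u i → Cong k (u * e * k + i) i
      mod-k u i = cong-+ (cong-multiple (u * e)) cong-refl
      distinct : ∀ i j → Cong k (coord ξ (toℕ i)) (coord ξ (toℕ j)) → i ≡ j
      distinct i j (congruent {x} {y} eq) = Fin.toℕ-injective (cong-<⇒≡ (Fin.toℕ<n i) (Fin.toℕ<n j)
        (cong-trans (cong-sym (mod-k x (toℕ i))) (cong-trans (cong-weaken k∣n (coord-injective {ξ} pξ
          (cong-trans (shift-k x (toℕ i)) (cong-trans (cong-reflexive eq) (cong-sym (shift-k y (toℕ j)))))))
          (mod-k y (toℕ j)))))

    extend-restrict : ∀ ξ → Intertwines ξ k l → extend (restrict ξ) ≡ ξ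
    extend-restrict ξ Ikl = ext-a λ i → begin
      app (extend (restrict ξ)) (a i)      ≡⟨ app-extend (restrict ξ) i ⟩
      a (lookup (restrict ξ) (i mod k) + i / k * l)  ≡⟨ cong (λ z → a (z + i / k * l))
         (trans (lookup-restrict ξ (i mod k)) (cong (coord ξ) (Fin.toℕ-fromℕ< _))) ⟩
      a (coord ξ (i % k) + i / k * l)      ≡⟨ cong a (+-comm _ (i / k * l)) ⟩
      a (i / k * l + coord ξ (i % k))      ≡⟨ a-cong (coord-shifts Ikl (i / k) (i % k)) ⟨
      a (coord ξ (i / k * k + i % k))      ≡⟨ cong (λ z → a (coord ξ z)) (trans (+-comm (i / k * k) _) (sym (m≡m%n+[m/n]*n i k))) ⟩
      a (coord ξ i)                        ≡⟨ a-coord ξ i ⟩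
      app ξ (a i)                          ∎
      where open ≡-Reasoning

    intertwiners-size : HasSize (λ ξ → IsPerm ξ × Intertwines ξ k l) (k ! * m ^ k)
    intertwiners-size = hasSize-image extend extend-injective
      (λ {v} s → extend-perm v s , extend-intertwines v)
      (λ {ξ} (pξ , Ikl) → restrict ξ , restrict-sequence ξ pξ Ikl , extend-restrict ξ Ikl)
      full-sequence-size

  -- Minimal pairs and membership in f

  intertwines-n : ∀ ξ → Intertwines ξ n n
  intertwines-n ξ = intertwines-cong (cong-sym cong-self) (cong-sym cong-self) (intertwines-zero ξ)

  -- The count at k = l = n with m = 1, where every permutation qualifies. It supplies the finite
  -- list from which representatives are drawn.
  perms : ∃ λ N → HasSize {Perm n} IsPerm N
  perms = _ , hasSize-cong (λ ξ → proj₁) (λ ξ pξ → pξ , intertwines-n ξ)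
    (Fixed.intertwiners-size n n 1 (sym (*-identityˡ n)) ∣-refl 1 (cong-reflexive (*-identityˡ n)))

  transversal : ∀ r t → ∃ λ c → NumClasses σ (λ ξ → Minimal ξ r t) c
  transversal r t = from-list (hasSize-filter (minimal? r t) (proj₂ perms))
    where
    from-list : (∃ λ N → HasSize (λ ξ → IsPerm ξ × Minimal ξ r t) N) → ∃ λ c → NumClasses σ (λ ξ → Minimal ξ r t) c
    from-list (_ , xs , _ , mem , _) =
      let rs , rs⊆xs , apart , cover = representatives _~_ ~? ~-refl xs in
      length rs , rs , refl , All.map (λ {ξ} i → to (mem ξ) i) rs⊆xs , apart ,
      λ ξ pξ min → cover (from (mem ξ) (pξ , min))

  -- Having minimal pair (r , t) is a property of the class, so these permutations form c disjoint
  -- classes of r n elements each.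
  minimal-size : ∀ {r t c} → 1 ≤ r → NumClasses σ (λ ξ → Minimal ξ r t) c →
                 HasSize (λ ξ → IsPerm ξ × Minimal ξ r t) (c * (r * n))
  minimal-size {r} {t} 1≤r (rs , refl , all , apart , cover) =
    hasSize-cong ⇒minimal minimal⇒ (subst (HasSize _) (sum-const {B = Perm n} (r * n) rs)
      (hasSize-⋃ Class (λ _ → r * n) rs
        (All.map (λ (pξ , min) → class-size pξ 1≤r min) all)
        (AllPairs.map (λ {α} {β} α≁β γ (_ , α~γ) (_ , β~γ) → α≁β (~-trans {α} {γ} {β} α~γ (~-sym {β} {γ} β~γ))) apart)))
    where
    ⇒minimal : ∀ β → Any (λ ρ → Class ρ β) rs → IsPerm β × Minimal β r t
    ⇒minimal β any with ρ , ρ∈rs , pβ , ρ~β ← find any =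
      pβ , minimal-resp-~ {ρ} {β} ρ~β (proj₂ (All.lookup all ρ∈rs))
    minimal⇒ : ∀ β → IsPerm β × Minimal β r t → Any (λ ρ → Class ρ β) rs
    minimal⇒ β (pβ , min) = Any.map (λ {ρ} β~ρ → pβ , ~-sym {β} {ρ} β~ρ) (cover β pβ min)

  -- In the second clause the class has n² elements by assumption and r n by its minimal pair (r ,
  -- t). Hence r = n, so n divides t and t = n.
  fMember⇒minimal : ∀ {k l} ξ → IsPerm ξ → FMember σ k l ξ → Minimal ξ k l
  fMember⇒minimal ξ pξ (inj₁ (_ , e , least)) =
    intertwines e , λ k₁ l₁ 1≤k₁ k₁<k r → least k₁ l₁ 1≤k₁ k₁<k (equation r)
  fMember⇒minimal ξ pξ (inj₂ (refl , refl , cs))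
    with r , t , 1≤r , lo , hi , min ← minimal-exists ξ =
    subst₂ (Minimal ξ) r≡n (vertex-top (subst (λ z → IsVertex n z t) r≡n (minimal⇒vertex pξ 1≤r min lo hi))) min
    where
    r≡n : r ≡ n
    r≡n = *-cancelʳ-≡ r n n (hasSize-unique (class-size pξ 1≤r min) cs)

  -- At k = n the vertex can only be ⟨ n , n ⟩, and the class size k n is n².
  minimal⇒fMember : ∀ {k l} → IsVertex n k l → ∀ ξ → IsPerm ξ → Minimal ξ k l → FMember σ k l ξ
  minimal⇒fMember {k} {l} vert ξ pξ min@(r , least) with k ≟ n
  ... | no k≢n = inj₁ (≤∧≢⇒< (∣⇒≤ (vertex-∣ n vert)) k≢n , equation r ,
                       λ k₁ l₁ 1≤k₁ k₁<k e → least k₁ l₁ 1≤k₁ k₁<k (intertwines e))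
  ... | yes refl = inj₂ (refl , vertex-top vert , class-size pξ (vertex-pos n vert) min)

  vertex-intertwiners-size : ∀ {k l} m → IsVertex n k l → n ≡ m * k →
                             HasSize (λ ξ → IsPerm ξ × Intertwines ξ k l) (k ! * m ^ k)
  vertex-intertwiners-size {k} {l} m vert@(_ , _ , g) n≡mk with e , el≈g ← bézout n l =
    Fixed.intertwiners-size k l m {{>-nonZero (vertex-pos n vert)}} n≡mk (subst (_∣ l) g (gcd[m,n]∣m l n)) e
      (cong-trans el≈g (cong-reflexive g))

  -- Splitting [ k , l ] by minimal pair

  module Recursion (c : ℕ → ℕ → ℕ) (c-classes : ∀ r t → NumClasses σ (λ ξ → Minimal ξ r t) (c r t))
                   {k l : ℕ} (kl : V n k l)
                   (ps : List (ℕ × ℕ)) (ps-unique : Unique ps)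
                   (∈ps : ∀ v → (v ∈ ps) ⇔ Prec n v (k , l)) where

    vert : IsVertex n k l
    vert = V⇒isVertex n kl

    -- `IsVertex` carries r ≥ 1 and 1 ≤ t ≤ n, which make the minimal pair unique and the parts
    -- disjoint.
    Part : ℕ × ℕ → Perm n → Set
    Part (r , t) ξ = IsVertex n r t × IsPerm ξ × Minimal ξ r t

    weight : ℕ × ℕ → ℕ
    weight (r , t) = c r t * (r * n)

    part-size : ∀ {r t} → IsVertex n r t → HasSize (Part (r , t)) (weight (r , t))
    part-size {r} {t} v = hasSize-cong (λ ξ p → v , p) (λ ξ → proj₂)
      (minimal-size (vertex-pos n v) (c-classes r t))

    part-sizes : All (λ v → HasSize (Part v) (weight v)) ((k , l) ∷ ps)
    part-sizes = part-size vert ∷ All.tabulate λ {v} i → part-size (V⇒isVertex n (prec-source n (to (∈ps v) i)))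

    parts-disjoint : AllPairs (λ v w → ∀ ξ → Part v ξ → Part w ξ → ⊥) ((k , l) ∷ ps)
    parts-disjoint = AllPairs.map
      (λ v≢w ξ (v@(lo , hi , _) , pξ , min) (v′@(lo′ , hi′ , _) , _ , min′) →
        v≢w (minimal-unique pξ min min′ (vertex-pos n v) lo hi (vertex-pos n v′) lo′ hi′))
      -- ⟨ k , l ⟩ is not its own predecessor, since ≺ strictly increases the first entry.
      (All.tabulate (λ {v} i e → <-irrefl (cong proj₁ (sym e)) (proj₁ (prec⇒below n (to (∈ps v) i)))) ∷ ps-unique)

    parts⇒intertwines : ∀ ξ → Any (λ v → Part v ξ) ((k , l) ∷ ps) → IsPerm ξ × Intertwines ξ k l
    parts⇒intertwines ξ (here (_ , pξ , r , _)) = pξ , r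
    parts⇒intertwines ξ (there any)
      with (r , t) , i , _ , pξ , Irt , _ ← find any
      with _ , q , k≡rq , l≈tq ← prec⇒below n (to (∈ps (r , t)) i) =
      pξ , intertwines-cong (cong-reflexive (trans (*-comm q r) (sym k≡rq)))
                  (cong-trans (cong-reflexive (*-comm q t)) (cong-sym l≈tq)) (intertwines-* q Irt)

    -- The pair (k , l) is q times the minimal pair (r , t). If r < k, then ⟨ r , t ⟩ is a
    -- predecessor; otherwise r = k, and the first entry determines the second, so t = l.
    intertwines⇒parts : ∀ ξ → IsPerm ξ × Intertwines ξ k l → Any (λ v → Part v ξ) ((k , l) ∷ ps)
    intertwines⇒parts ξ (pξ , Ikl) with minimal-exists ξ
    ... | r , t , 1≤r , lo , hi , min with minimal-∣ pξ 1≤r min Ikl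
    ...   | q , k≡qr , l≈qt = place (r <? k)
      where
      v : IsVertex n r t
      v = minimal⇒vertex pξ 1≤r min lo hi
      place : Dec (r < k) → Any (λ v → Part v ξ) ((k , l) ∷ ps)
      place (yes r<k) = there (lose (from (∈ps (r , t)) (below⇒prec n (isVertex⇒V n (V⇒2≤n kl) v) kl
        (r<k , q , trans k≡qr (*-comm q r) , cong-trans l≈qt (cong-reflexive (*-comm q t))))) (v , pξ , min))
      place (no r≮k) = here (vert , pξ , subst₂ (Minimal ξ) r≡k t≡l min)
        where
        r≡k : r ≡ k
        r≡k = ≤-antisym (∣⇒≤ {{>-nonZero (vertex-pos n vert)}} (divides q k≡qr)) (≮⇒≥ r≮k)
        t≡l : t ≡ l
        t≡l = cong-range⇒≡ lo hi (proj₁ vert) (proj₁ (proj₂ vert))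
          (intertwines-functional pξ (subst (λ z → Intertwines ξ z t) r≡k (proj₁ min)) Ikl)

    g : ℕ × ℕ → ℕ
    g v = proj₁ v * c (proj₁ v) (proj₂ v)

    s : ℕ
    s = sum (map g ps)

    sum-over : SumOver (λ v → Prec n v (k , l)) g s
    sum-over = ps , ps-unique , ∈ps , refl

    weight-g : ∀ v → weight v ≡ n * g v
    weight-g (r , t) = solve 3 (λ c r n → c :* (r :* n) := n :* (r :* c)) refl (c r t) r n

    count : ∀ m → n ≡ m * k → n * (k * c k l + s) ≡ k ! * m ^ k
    count m n≡mk = trans (sym (sum-map-scale n g weight weight-g ((k , l) ∷ ps)))
      (hasSize-unique (hasSize-cong parts⇒intertwines intertwines⇒parts (hasSize-⋃ Part weight ((k , l) ∷ ps) part-sizes parts-disjoint))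
        (vertex-intertwiners-size m vert n≡mk))

    recursion : k * c k l + s ≡ (k ∸ 1) ! * ndiv n k ^ (k ∸ 1)
    -- A variable equal to `k` is split instead of `k` itself, so that k - 1 and `ndiv` reduce on
    -- the right while the rest stays fixed.
    recursion = by-cases k refl (vertex-∣ n vert)
      where
      by-cases : ∀ k′ → k′ ≡ k → k ∣ n → k * c k l + s ≡ (k′ ∸ 1) ! * ndiv n k′ ^ (k′ ∸ 1)
      by-cases zero    e _ = ⊥-elim (<⇒≢ (vertex-pos n vert) e)
      -- The factor n = m k is taken out of k! m^k: k from the factorial and one m from the power.
      by-cases (suc j) e (divides m n≡mk) = *-cancelˡ-≡ _ _ n (begin
        n * (k * c k l + s)                 ≡⟨ count m n≡mk ⟩
        k ! * m ^ k                         ≡⟨ cong (λ z → z ! * m ^ z) e ⟨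
        suc j * j ! * (m * m ^ j)           ≡⟨ lem (suc j) (j !) m (m ^ j) ⟩
        (m * suc j) * (j ! * m ^ j)         ≡⟨ cong₂ (λ x y → x * (j ! * y ^ j)) n≡ (trans (sym (m*n/n≡m m (suc j))) (cong (_/ suc j) n≡)) ⟩
        n * (j ! * (n / suc j) ^ j)         ∎)
        where
        open ≡-Reasoning
        n≡ : m * suc j ≡ n
        n≡ = trans (cong (m *_) e) (sym n≡mk)
        lem : ∀ a b c d → a * b * (c * d) ≡ (c * a) * (b * d)
        lem = solve 4 (λ a b c d → a :* b :* (c :* d) := (c :* a) :* (b :* d)) refl

theorem2 : (n : ℕ) → 1 ≤ n → (σ : Perm n) → IsPerm σ → IsNCycle σ →
    Σ (ℕ → ℕ → ℕ) λ c →
      (∀ k l → V n k l → NumClasses σ (FMember σ k l) (c k l)) ×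
      (∀ k l → V n k l →
        Σ ℕ λ s →
          SumOver (λ v → Prec n v (k , l)) (λ v → proj₁ v * c (proj₁ v) (proj₂ v)) s ×
          k * c k l + s ≡ (k ∸ 1) ! * ndiv n k ^ (k ∸ 1))
theorem2 n 1≤n σ σ-perm (a , a-injective , σ-a) =
  c ,
  (λ k l kl → numClasses-cong {σ = σ} (minimal⇒fMember (V⇒isVertex n kl)) fMember⇒minimal (c-classes k l)) ,
  (λ k l kl →
    let _ , ps , ps-unique , ∈ps , _ = predecessors n kl
        open Recursion c c-classes kl ps ps-unique ∈ps
    in s , sum-over , recursion)
  where
  instance
    _ = >-nonZero 1≤n
  open Cycle n σ σ-perm a a-injective σ-a
  c : ℕ → ℕ → ℕ
  c r t = proj₁ (transversal r t)
  c-classes : ∀ r t → NumClasses σ (λ ξ → Cycle.Minimal n σ σ-perm a a-injective σ-a ξ r t) (c r t)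
  c-classes r t = proj₂ (transversal r t)
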